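{- There is an absolute constant $C>0$ such that the following holds. Let $k,n,d$ be positive integers with $k\ge 2$ and $n\ge d$. If $\mathcal{F}\subset[k]^n$ does not contain a $d$-dimensional Boolean algebra, then $$|\mathcal{F}|\le C\,k^{\,n-1/2^{d-1}}\,n^{ -1/2^d}.$$ In particular, $b(n,d)\le C\,2^n n^{ -1/2^d}$.
   Context: $[k]^n$ denotes the set of vectors with entries in $\{1,\dots,k\}$. Two vectors $\mathbf v,\mathbf w\in\{0,1,\dots,k-1\}^n$ are disjoint if for every $i\in[n]$ at most one of $\mathbf v(i),\mathbf w(i)$ is nonzero. A set $B\subset[k]^n$ is a $d$-dimensional Boolean algebra if there exist $\mathbf v_0\in[k]^n$ and nonzero, pairwise disjoint vectors $\mathbf v_1,\dots,\mathbf v_d\in\{0,1,\dots,k-1\}^n$ such that $B=\{\mathbf v_0+\sum_{i\in I}\mathbf v_i: I\subset[d]\}$ (all these sums lying in $[k]^n$). In $2^{[n]}$, a $d$-dimensional Boolean algebra is a family $\{X_0\cup\bigcup_{i\in I}X_i: I\subset[d]\}$ with $X_0,X_1,\dots,X_d\subset[n]$ pairwise disjoint and $X_1,\dots,X_d$ nonempty; $b(n,d)$ is the maximum size of a family in $2^{[n]}$ containing no $d$-dimensional Boolean algebra. The paper's $O(\cdot)$ is rendered with an absolute constant $C$. -}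

module Defs where

open import Data.Nat using (ℕ; zero; suc; _+_; _*_; _^_; _≤_)
open import Data.Fin using (Fin; toℕ)
open import Data.Bool using (Bool; true; false; if_then_else_; _∧_; _∨_)
open import Data.Vec using (Vec; lookup; tabulate)
open import Data.List using (List; length)
open import Data.Nat.ListAction using (sum)
import Data.List as List
open import Data.List.Membership.Propositional using (_∈_)
open import Data.Product using (Σ; ∃; _×_)
open import Data.Sum using (_⊎_)
open import Relation.Binary.PropositionalEquality using (_≡_; _≢_)

-- An element of [k]^n: a vector whose i-th entry  a : Fin k  encodes the value  toℕ a + 1 ∈ {1,…,k}.
Cube : ℕ → ℕ → Set
Cube k n = Vec (Fin k) n

val : ∀ {k n} → Cube k n → Fin n → ℕ
val x i = suc (toℕ (lookup x i))

subsetSum : ∀ {d n} → (Fin d → Bool) → (Fin d → Fin n → ℕ) → Fin n → ℕ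
subsetSum {d} I v i = sum (List.tabulate {n = d} (λ j → if I j then v j i else 0))

ContainsBA : ∀ {k n} → ℕ → List (Cube k n) → Set
ContainsBA {k} {n} d F =
  Σ (Cube k n) λ v₀ →
  Σ (Fin d → Fin n → ℕ) λ v →
    (∀ j i → suc (v j i) ≤ k)
  × (∀ j → ∃ λ i → v j i ≢ 0)
  × (∀ j j' → j ≢ j' → ∀ i → v j i ≡ 0 ⊎ v j' i ≡ 0)
  × (∀ (I : Fin d → Bool) → Σ (Cube k n) λ w → w ∈ F × (∀ i → val w i ≡ val v₀ i + subsetSum I v i))

PSet : ℕ → Set
PSet n = Vec Bool n

anyIn : ∀ {d n} → (Fin d → Bool) → (Fin d → Fin n → Bool) → Fin n → Bool
anyIn {d} I X i = List.foldr _∨_ false (List.tabulate {n = d} (λ j → I j ∧ X j i))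

ContainsBAset : ∀ {n} → ℕ → List (PSet n) → Set
ContainsBAset {n} d F =
  Σ (PSet n) λ X₀ →
  Σ (Fin d → Fin n → Bool) λ X →
    (∀ j → ∃ λ i → X j i ≡ true)
  × (∀ j i → X j i ≡ true → lookup X₀ i ≡ false)
  × (∀ j j' → j ≢ j' → ∀ i → X j i ≡ false ⊎ X j' i ≡ false)
  × (∀ (I : Fin d → Bool) → tabulate (λ i → lookup X₀ i ∨ anyIn I X i) ∈ F)

{-# OPTIONS --safe #-}
-- Cover [k]^m, m = ⌊n/d⌋, by N = O(k^(m-1) / √m) chains (de Bruijn–Tengbergen–Kruyswijk), and let F have density α.
-- Writing points as x ++ y with x ∈ [k]^m and counting, for every y, the consecutive elements of F along each
-- chain whose gap is at most G ≈ 2/α, one finds x ≺ x′ for which the set of all y with both x ++ y and x′ ++ y in F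
-- has density at least α²/12, unless α ≤ 3N/k^m.  A (d-1)-dimensional Boolean algebra in that set extends by
-- x′ - x to a d-dimensional one in F, so d steps give (α/12)^(2^d) ≤ (N / (4 k^m))².
-- N is at most the middle layer of [k]^m.  For k = 2h or 2h + 1, pairing j with j + h in every coordinate
-- but one reduces the size of that layer, in Littlewood–Offord fashion, to the bound on central binomial coefficients.
module Submission where

open import Defs
open import Data.Nat
open import Data.Nat.Properties
open import Data.Nat.DivMod
open import Data.Nat.Divisibility using (∣-refl; divides)
open import Data.Nat.ListAction using (sum)
open import Data.Nat.Tactic.RingSolver using (solve-∀)
open import Data.Bool using (Bool; true; false; if_then_else_; _∧_; _∨_)
open import Data.Empty using (⊥; ⊥-elim)
open import Data.Fin as Fin using (Fin; toℕ; splitAt; _↑ˡ_; _↑ʳ_)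
import Data.Fin.Properties as Fin
open import Data.List using (List; []; _∷_; _++_; map; concatMap; length; take; downFrom)
import Data.List.Properties as List
open import Data.List.Membership.Propositional using (_∈_)
open import Data.List.Membership.Propositional.Properties using (∈-map⁻)
open import Data.List.Relation.Unary.All as All using (All; []; _∷_)
import Data.List.Relation.Unary.All.Properties as All
open import Data.List.Relation.Unary.AllPairs as AllPairs using (AllPairs; []; _∷_)
import Data.List.Relation.Unary.AllPairs.Properties as AllPairs
open import Data.List.Relation.Unary.Any using (here; there)
open import Data.List.Relation.Unary.Unique.Propositional using (Unique)
open import Data.List.Relation.Unary.Unique.Propositional.Properties using (map⁺)
open import Data.Product using (Σ; ∃; _×_; _,_; proj₁; proj₂)
open import Data.Sum using (_⊎_; inj₁; inj₂; [_,_]′)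
open import Data.Vec as Vec using ([]; _∷_; lookup)
import Data.Vec.Properties as Vec
open import Function using (_∘_)
open import Relation.Binary.PropositionalEquality
open import Relation.Nullary using (¬_; Dec; yes; no)

-- The normalisation by 12 is what closes the induction: if a common set has density β = α²/12, then
-- β/12 = (α/12)², so each dimension only doubles the exponent, while the right side (N / (4 k^m))²
-- stays fixed because all steps use blocks of the same length m. The 12 itself is dictated by the
-- choice of G: with it the counting inequality becomes a quadratic that fails on an interval long
-- enough to contain a multiple of |F|. Cutting the n coordinates into d blocks costs a factor of
-- order d, which must not reach the constant. It enters as 4d ≤ 4^(2^d), so that the 2^d-th root
-- leaves a factor 4, and C = 4 · 12. In the layer estimate one coordinate is spared because summing
-- over it turns the indicator of a single rank into that of an interval of length k. Four blocks of
-- length h cover this interval, the resulting majorant depends on ⌊s/h⌋ only, and a shift by h acts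
-- on it as a shift by one. The spared coordinate is also why N is of order k^(m-1) / √m and not k^m
-- / √m.

-- Central binomial coefficients

-- binomial t s = (t + s)! / (t! s!)
binomial : ℕ → ℕ → ℕ
binomial zero    s       = 1
binomial (suc t) zero    = 1
binomial (suc t) (suc s) = binomial t (suc s) + binomial (suc t) s

binomial-zeroʳ : ∀ t → binomial t 0 ≡ 1
binomial-zeroʳ zero    = refl
binomial-zeroʳ (suc t) = refl

binomial-comm : ∀ t s → binomial t s ≡ binomial s t
binomial-comm zero    s       = sym (binomial-zeroʳ s)
binomial-comm (suc t) zero    = refl
binomial-comm (suc t) (suc s) = trans
  (cong₂ _+_ (binomial-comm t (suc s)) (binomial-comm (suc t) s))
  (+-comm (binomial (suc s) t) (binomial s (suc t)))

-- The additive definition hides the ratio of neighbouring coefficients; this recovers it without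
-- division, by Pascal's rule.
binomial-absorb : ∀ t s → suc t * binomial (suc t) s ≡ suc (t + s) * binomial t s
binomial-absorb t zero rewrite binomial-zeroʳ t | +-identityʳ t = refl
binomial-absorb zero (suc s) = begin
  1 * (1 + binomial 1 s)      ≡⟨ expand (binomial 1 s) ⟩
  1 + 1 * binomial 1 s        ≡⟨ cong suc (binomial-absorb 0 s) ⟩
  1 + suc s * 1                  ≡⟨ collect s ⟩
  suc (suc s) * 1                ∎
  where
  open ≡-Reasoning
  expand : ∀ a → 1 * (1 + a) ≡ 1 + 1 * a
  expand = solve-∀
  collect : ∀ s → 1 + suc s * 1 ≡ suc (suc s) * 1
  collect = solve-∀
binomial-absorb (suc t) (suc s) = begin
  suc (suc t) * (x + y + z)
    ≡⟨ expand t (x + y) z ⟩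
  (x + y) + suc t * (x + y) + suc (suc t) * z
    ≡⟨ cong₂ (λ u v → (x + y) + u + v) (binomial-absorb t (suc s)) (binomial-absorb (suc t) s) ⟩
  (x + y) + suc (t + suc s) * x + suc (suc t + s) * y
    ≡⟨ collect t s x y ⟩
  suc (suc t + suc s) * (x + y) ∎
  where
  open ≡-Reasoning
  x = binomial t (suc s)
  y = binomial (suc t) s
  z = binomial (suc (suc t)) s
  expand : ∀ t w z → suc (suc t) * (w + z) ≡ w + suc t * w + suc (suc t) * z
  expand = solve-∀
  collect : ∀ t s x y → (x + y) + suc (t + suc s) * x + suc (suc t + s) * y ≡ suc (suc t + suc s) * (x + y)
  collect = solve-∀

-- Consecutive central coefficients have ratio 2 (2t + 1) / (t + 1), so the step needs (2t + 1)(2t +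
-- 3) ≤ 4 (t + 1)², where the two sides differ by exactly 1.
binomial-diagonal-bound : ∀ t → binomial t t * binomial t t * suc (t + t) ≤ 4 ^ (t + t)
binomial-diagonal-bound zero    = ≤-refl
binomial-diagonal-bound (suc t) = *-cancelˡ-≤ (suc t * suc t) (begin
  (suc t * suc t) * (c * c * suc (suc t + suc t))
    ≡⟨ e₁ t c ⟩
  (suc t * c) * (suc t * c) * (3 + (t + t))
    ≡⟨ cong (λ u → u * u * (3 + (t + t))) ratio ⟩
  (2 * (suc (t + t) * b)) * (2 * (suc (t + t) * b)) * (3 + (t + t))
    ≡⟨ e₂ t b ⟩
  (b * b * suc (t + t)) * (4 * (suc (t + t) * (3 + (t + t))))
    ≤⟨ *-mono-≤ (binomial-diagonal-bound t) (*-monoʳ-≤ 4 (≤-trans (n≤1+n _) (≤-reflexive (e₃ t)))) ⟩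
  4 ^ (t + t) * (4 * (4 * (suc t * suc t)))
    ≡⟨ e₄ t (4 ^ (t + t)) ⟩
  (suc t * suc t) * (4 * (4 * 4 ^ (t + t)))
    ≡⟨ cong (λ u → (suc t * suc t) * (4 * 4 ^ u)) (sym (+-suc t t)) ⟩
  (suc t * suc t) * 4 ^ (suc t + suc t) ∎)
  where
  open ≤-Reasoning
  b = binomial t t
  c = binomial (suc t) (suc t)
  e₀ : ∀ x y → 2 * (x * y) ≡ x * (y + y)
  e₀ = solve-∀
  e₁ : ∀ t c → (suc t * suc t) * (c * c * suc (suc t + suc t)) ≡ (suc t * c) * (suc t * c) * (3 + (t + t))
  e₁ = solve-∀
  e₂ : ∀ t b → (2 * (suc (t + t) * b)) * (2 * (suc (t + t) * b)) * (3 + (t + t)) ≡ (b * b * suc (t + t)) * (4 * (suc (t + t) * (3 + (t + t))))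
  e₂ = solve-∀
  e₃ : ∀ t → suc (suc (t + t) * (3 + (t + t))) ≡ 4 * (suc t * suc t)
  e₃ = solve-∀
  e₄ : ∀ t p → p * (4 * (4 * (suc t * suc t))) ≡ (suc t * suc t) * (4 * (4 * p))
  e₄ = solve-∀
  ratio : suc t * c ≡ 2 * (suc (t + t) * b)
  ratio = sym (trans (cong (2 *_) (sym (binomial-absorb t t)))
    (trans (e₀ (suc t) (binomial (suc t) t)) (cong (λ u → suc t * (u + binomial (suc t) t)) (binomial-comm (suc t) t))))

-- Moving off the diagonal multiplies the coefficient by (t + s + 1) / (t + 1), and s ≤ t gives (t +
-- s + 1)(t + s + 2) ≤ (2t + 2)², which is covered by the new factor 4 on the right.
binomial-bound-≥ : ∀ δ s → let t = δ + s in binomial t s * binomial t s * suc (t + s) ≤ 4 ^ (t + s)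
binomial-bound-≥ zero    s = binomial-diagonal-bound s
binomial-bound-≥ (suc δ) s = *-cancelˡ-≤ (suc t * suc t) (begin
  (suc t * suc t) * (c * c * suc (suc t + s))
    ≡⟨ e₁ t s c ⟩
  (suc t * c) * (suc t * c) * suc (suc t + s)
    ≡⟨ cong (λ u → u * u * suc (suc t + s)) (binomial-absorb t s) ⟩
  (suc (t + s) * b) * (suc (t + s) * b) * suc (suc t + s)
    ≡⟨ e₂ t s b ⟩
  (b * b * suc (t + s)) * (suc (t + s) * suc (suc t + s))
    ≤⟨ *-mono-≤ (binomial-bound-≥ δ s) (*-mono-≤ (m≤n⇒m≤1+n (s≤s (+-monoʳ-≤ t (m≤n+m s δ)))) (s≤s (s≤s (+-monoʳ-≤ t (m≤n+m s δ))))) ⟩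
  4 ^ (t + s) * ((2 + (t + t)) * (2 + (t + t)))
    ≡⟨ e₃ t (4 ^ (t + s)) ⟩
  (suc t * suc t) * (4 * 4 ^ (t + s)) ∎)
  where
  open ≤-Reasoning
  t = δ + s
  b = binomial t s
  c = binomial (suc t) s
  e₁ : ∀ t s c → (suc t * suc t) * (c * c * suc (suc t + s)) ≡ (suc t * c) * (suc t * c) * suc (suc t + s)
  e₁ = solve-∀
  e₂ : ∀ t s b → (suc (t + s) * b) * (suc (t + s) * b) * suc (suc t + s) ≡ (b * b * suc (t + s)) * (suc (t + s) * suc (suc t + s))
  e₂ = solve-∀
  e₃ : ∀ t p → p * ((2 + (t + t)) * (2 + (t + t))) ≡ (suc t * suc t) * (4 * p)
  e₃ = solve-∀

binomial-bound : ∀ t s → binomial t s * binomial t s * suc (t + s) ≤ 4 ^ (t + s)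
binomial-bound t s with ≤-total s t
... | inj₁ s≤t = subst (λ u → binomial u s * binomial u s * suc (u + s) ≤ 4 ^ (u + s))
                   (m∸n+n≡m s≤t) (binomial-bound-≥ (t ∸ s) s)
... | inj₂ t≤s = subst₂ (λ x y → x * x * suc y ≤ 4 ^ y) (binomial-comm s t) (+-comm s t)
                   (subst (λ u → binomial u t * binomial u t * suc (u + t) ≤ 4 ^ (u + t))
                     (m∸n+n≡m t≤s) (binomial-bound-≥ (s ∸ t) t))

-- Anti-concentration of the rank

square-cancel-≤ : ∀ {m n} → m * m ≤ n * n → m ≤ n
square-cancel-≤ m²≤n² = ≮⇒≥ λ n<m → <⇒≱ (*-mono-< n<m n<m) m²≤n²

am-gm : ∀ x y → 2 * (x * y) ≤ x * x + y * y
am-gm x y with ≤-total x y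
... | inj₁ x≤y = subst (λ y → 2 * (x * y) ≤ x * x + y * y) (m+[n∸m]≡n x≤y)
                   (≤-trans (m≤m+n _ ((y ∸ x) * (y ∸ x))) (≤-reflexive (square x (y ∸ x))))
  where
  square : ∀ x d → 2 * (x * (x + d)) + d * d ≡ x * x + (x + d) * (x + d)
  square = solve-∀
... | inj₂ y≤x = subst (λ x → 2 * (x * y) ≤ x * x + y * y) (m+[n∸m]≡n y≤x)
                   (≤-trans (m≤m+n _ ((x ∸ y) * (x ∸ y))) (≤-reflexive (square y (x ∸ y))))
  where
  square : ∀ y d → 2 * ((y + d) * y) + d * d ≡ (y + d) * (y + d) + y * y
  square = solve-∀

-- The triangle inequality  x ≤ p √(A/c), y ≤ q √(A/c)  ⇒  x + y ≤ (p + q) √(A/c).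
square-bound-+ : ∀ {x y} p q {A} c → x * x * c ≤ p * p * A → y * y * c ≤ q * q * A →
                 (x + y) * (x + y) * c ≤ (p + q) * (p + q) * A
square-bound-+ {x} {y} p q {A} c hx hy = begin
  (x + y) * (x + y) * c                         ≡⟨ expand x y c ⟩
  x * x * c + 2 * (x * y * c) + y * y * c       ≤⟨ +-mono-≤ (+-mono-≤ hx (*-monoʳ-≤ 2 cross)) hy ⟩
  p * p * A + 2 * (p * q * A) + q * q * A       ≡⟨ sym (expand p q A) ⟩
  (p + q) * (p + q) * A                         ∎
  where
  open ≤-Reasoning
  expand : ∀ x y c → (x + y) * (x + y) * c ≡ x * x * c + 2 * (x * y * c) + y * y * c
  expand = solve-∀
  regroup : ∀ x y c → x * y * c * (x * y * c) ≡ (x * x * c) * (y * y * c)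
  regroup = solve-∀
  cross : x * y * c ≤ p * q * A
  cross = square-cancel-≤ (begin
    x * y * c * (x * y * c)      ≡⟨ regroup x y c ⟩
    (x * x * c) * (y * y * c)    ≤⟨ *-mono-≤ hx hy ⟩
    (p * p * A) * (q * q * A)    ≡⟨ sym (regroup p q A) ⟩
    p * q * A * (p * q * A)      ∎)

sumBelow : ℕ → (ℕ → ℕ) → ℕ
sumBelow zero    g = 0
sumBelow (suc n) g = g n + sumBelow n g

+-interchange : ∀ a b c d → (a + b) + (c + d) ≡ (a + c) + (b + d)
+-interchange = solve-∀

sumBelow-cong : ∀ n {f g} → (∀ j → f j ≡ g j) → sumBelow n f ≡ sumBelow n g
sumBelow-cong zero    eq = refl
sumBelow-cong (suc n) eq = cong₂ _+_ (eq n) (sumBelow-cong n eq)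

sumBelow-+ : ∀ n f g → sumBelow n (λ j → f j + g j) ≡ sumBelow n f + sumBelow n g
sumBelow-+ zero    f g = refl
sumBelow-+ (suc n) f g = trans (cong (f n + g n +_) (sumBelow-+ n f g))
                               (+-interchange (f n) (g n) (sumBelow n f) (sumBelow n g))

sumBelow-split : ∀ n h g → sumBelow (n + h) g ≡ sumBelow n (λ j → g (j + h)) + sumBelow h g
sumBelow-split zero    h g = refl
sumBelow-split (suc n) h g = trans (cong (g (n + h) +_) (sumBelow-split n h g))
                                   (sym (+-assoc (g (n + h)) _ _))

sumBelow-double : ∀ h g → sumBelow (h + h) g ≡ sumBelow h (λ j → g j + g (j + h))
sumBelow-double h g = trans (sumBelow-split h h g)
  (trans (+-comm _ (sumBelow h g)) (sym (sumBelow-+ h g (λ j → g (j + h)))))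

sumBelow-square-bound : ∀ n g {A} c → (∀ j → g j * g j * c ≤ A) → sumBelow n g * sumBelow n g * c ≤ n * n * A
sumBelow-square-bound zero    g     c le = z≤n
sumBelow-square-bound (suc n) g {A} c le =
  square-bound-+ {g n} {sumBelow n g} 1 n c (≤-trans (le n) (≤-reflexive (sym (+-identityʳ A)))) (sumBelow-square-bound n g c le)

δ : ℕ → ℕ → ℕ
δ zero    zero    = 1
δ zero    (suc j) = 0
δ (suc i) zero    = 0
δ (suc i) (suc j) = δ i j

δ-refl : ∀ i → δ i i ≡ 1
δ-refl zero    = refl
δ-refl (suc i) = δ-refl i

δ-≢ : ∀ {i j} → i ≢ j → δ i j ≡ 0
δ-≢ {zero}  {zero}  i≢j = ⊥-elim (i≢j refl)
δ-≢ {zero}  {suc j} i≢j = refl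
δ-≢ {suc i} {zero}  i≢j = refl
δ-≢ {suc i} {suc j} i≢j = δ-≢ (λ eq → i≢j (cong suc eq))

-- doubled h r g s = Σ_t C(r,t) g(s + h t)
doubled : ℕ → ℕ → (ℕ → ℕ) → ℕ → ℕ
doubled h zero    g s = g s
doubled h (suc r) g s = doubled h r g s + doubled h r g (s + h)

doubled-mono : ∀ h r {f g} → (∀ s → f s ≤ g s) → ∀ s → doubled h r f s ≤ doubled h r g s
doubled-mono h zero    le s = le s
doubled-mono h (suc r) le s = +-mono-≤ (doubled-mono h r le s) (doubled-mono h r le (s + h))

-- A shift by h raises ⌊s/h⌋ by exactly one, so on functions of this quotient the step h becomes the
-- step 1 and binomial coefficients appear.
doubled-quotient : ∀ h .{{_ : NonZero h}} r ψ s → doubled h r (λ s → ψ (s / h)) s ≡ doubled 1 r ψ (s / h)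
doubled-quotient h zero    ψ s = refl
doubled-quotient h (suc r) ψ s = cong₂ _+_ (doubled-quotient h r ψ s)
  (trans (doubled-quotient h r ψ (s + h))
         (cong (doubled 1 r ψ) (trans (+-distrib-/-∣ʳ s ∣-refl) (cong (s / h +_) (n/n≡1 h)))))

doubled-sumBelow : ∀ r n (φ : ℕ → ℕ) u →
  doubled 1 r (λ u → sumBelow n (λ i → φ (u + i))) u ≡ sumBelow n (λ i → doubled 1 r φ (u + i))
doubled-sumBelow zero    n φ u = refl
doubled-sumBelow (suc r) n φ u = trans
  (cong₂ _+_ (doubled-sumBelow r n φ u) (trans (doubled-sumBelow r n φ (u + 1))
    (sumBelow-cong n λ i → cong (doubled 1 r φ) (swap u i))))
  (sym (sumBelow-+ n (λ i → doubled 1 r φ (u + i)) (λ i → doubled 1 r φ (u + i + 1))))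
  where
  swap : ∀ u i → u + 1 + i ≡ u + i + 1
  swap = solve-∀

doubled-δ-above : ∀ r {Q u} → Q < u → doubled 1 r (δ Q) u ≡ 0
doubled-δ-above zero    Q<u = δ-≢ (<⇒≢ Q<u)
doubled-δ-above (suc r) Q<u = cong₂ _+_ (doubled-δ-above r Q<u) (doubled-δ-above r (m≤n⇒m≤n+o 1 Q<u))

doubled-δ-below : ∀ r {Q u} → u + r < Q → doubled 1 r (δ Q) u ≡ 0
doubled-δ-below zero    {Q} {u} lt = δ-≢ λ eq → <⇒≢ lt (trans (+-identityʳ u) (sym eq))
doubled-δ-below (suc r) {Q} {u} lt = cong₂ _+_
  (doubled-δ-below r (≤-<-trans (+-monoʳ-≤ u (n≤1+n r)) lt))
  (doubled-δ-below r (subst (_< Q) (sym (+-assoc u 1 r)) lt))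

doubled-δ : ∀ t s u → doubled 1 (t + s) (δ (u + t)) u ≡ binomial t s
doubled-δ zero zero    u rewrite +-identityʳ u = δ-refl u
doubled-δ zero (suc s) u = cong₂ _+_ (doubled-δ zero s u)
  (doubled-δ-above s (subst (_< u + 1) (sym (+-identityʳ u)) (m<m+n u z<s)))
doubled-δ (suc t) zero u = cong₂ _+_
  (doubled-δ-below (t + 0) (+-monoʳ-< u (s≤s (≤-reflexive (+-identityʳ t)))))
  (trans (cong (λ Q → doubled 1 (t + 0) (δ Q) (u + 1)) (sym (+-assoc u 1 t)))
         (trans (doubled-δ t zero (u + 1)) (binomial-zeroʳ t)))
doubled-δ (suc t) (suc s) u = trans (+-comm (doubled 1 (t + suc s) (δ (u + suc t)) u) _) (cong₂ _+_
  (trans (cong (λ Q → doubled 1 (t + suc s) (δ Q) (u + 1)) (sym (+-assoc u 1 t))) (doubled-δ t (suc s) (u + 1)))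
  (trans (cong (λ r → doubled 1 r (δ (u + suc t)) u) (+-suc t s)) (doubled-δ (suc t) s u)))

doubled-δ-bound : ∀ r Q u → let x = doubled 1 r (δ Q) u in x * x * suc r ≤ 4 ^ r
doubled-δ-bound r Q u with Q <? u
... | yes Q<u rewrite doubled-δ-above r Q<u = z≤n
... | no  Q≮u with (u + r) <? Q
... | yes lt rewrite doubled-δ-below r lt = z≤n
-- Here u ≤ Q ≤ u + r, so that Q = u + t and r = t + s, and the value is a binomial coefficient.
... | no  ≮Q = subst₂ (λ r Q → let x = doubled 1 r (δ Q) u in x * x * suc r ≤ 4 ^ r)
  (m+[n∸m]≡n t≤r) (m+[n∸m]≡n u≤Q)
  (subst (λ x → x * x * suc (t + s) ≤ 4 ^ (t + s)) (sym (doubled-δ t s u)) (binomial-bound t s))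
  where
  u≤Q = ≮⇒≥ Q≮u
  t = Q ∸ u
  s = r ∸ t
  t≤r : t ≤ r
  t≤r = m≤n+o⇒m∸n≤o Q u (≮⇒≥ ≮Q)

window : ℕ → ℕ → ℕ → ℕ
window k mid s = sumBelow k (λ j → δ mid (s + j))

sumBelow-δ-none : ∀ n {mid} s → (∀ j → j < n → s + j ≢ mid) → window n mid s ≡ 0
sumBelow-δ-none zero    s ne = refl
sumBelow-δ-none (suc n) s ne = cong₂ _+_ (δ-≢ (λ eq → ne n ≤-refl (sym eq)))
  (sumBelow-δ-none n s (λ j j<n → ne j (m<n⇒m<1+n j<n)))

sumBelow-δ-≤1 : ∀ n mid s → window n mid s ≤ 1
sumBelow-δ-≤1 zero    mid s = z≤n
sumBelow-δ-≤1 (suc n) mid s with mid ≟ s + n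
... | no  ≢  rewrite δ-≢ ≢ = sumBelow-δ-≤1 n mid s
... | yes refl rewrite δ-refl (s + n) =
  s≤s (≤-reflexive (sumBelow-δ-none n s (λ j j<n eq → <⇒≢ j<n (+-cancelˡ-≡ s j n eq))))

sumBelow-lower : ∀ n g {j} → j < n → g j ≤ sumBelow n g
sumBelow-lower (suc n) g {j} j<1+n with m≤n⇒m<n∨m≡n (s≤s⁻¹ j<1+n)
... | inj₁ j<n  = m≤n⇒m≤o+n (g n) (sumBelow-lower n g j<n)
... | inj₂ refl = m≤m+n (g n) _

-- A window of length at most 3h that contains `mid` begins in the block of `mid` or in one of the
-- three blocks before it. The majorant depends on s through ⌊s/h⌋ alone, as `doubled-quotient`
-- demands.
window-≤-blocks : ∀ k h .{{_ : NonZero h}} mid → k ≤ 3 * h → ∀ s →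
  window k mid s ≤ sumBelow 4 (λ i → δ (mid / h) (s / h + i))
window-≤-blocks k h mid k≤3h s with s ≤? mid | mid <? s + k
... | no s≰mid | _ = ≤-trans (≤-reflexive (sumBelow-δ-none k s λ j _ eq → s≰mid (m+n≤o⇒m≤o s (≤-reflexive eq)))) z≤n
... | yes _ | no mid≮ = ≤-trans (≤-reflexive (sumBelow-δ-none k s λ j j<k eq → mid≮ (subst (_< s + k) eq (+-monoʳ-< s j<k)))) z≤n
... | yes s≤mid | yes mid<s+k = begin
  window k mid s                          ≤⟨ sumBelow-δ-≤1 k mid s ⟩
  1                                       ≡⟨ sym (δ-refl (mid / h)) ⟩
  δ (mid / h) (mid / h)                   ≡⟨ cong (δ (mid / h)) (sym (m+[n∸m]≡n (/-monoˡ-≤ h s≤mid))) ⟩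
  δ (mid / h) (s / h + (mid / h ∸ s / h)) ≤⟨ sumBelow-lower 4 (λ i → δ (mid / h) (s / h + i)) gap ⟩
  sumBelow 4 (λ i → δ (mid / h) (s / h + i)) ∎
  where
  open ≤-Reasoning
  blocks : mid / h ≤ 3 + s / h
  blocks = begin
    mid / h              ≤⟨ /-monoˡ-≤ h (≤-trans (<⇒≤ mid<s+k) (+-monoʳ-≤ s k≤3h)) ⟩
    (s + 3 * h) / h      ≡⟨ +-distrib-/-∣ʳ s (divides 3 refl) ⟩
    s / h + 3 * h / h    ≡⟨ cong (s / h +_) (m*n/n≡m 3 h) ⟩
    s / h + 3            ≡⟨ +-comm (s / h) 3 ⟩
    3 + s / h            ∎
  gap : mid / h ∸ s / h < 4
  gap = s≤s (m≤n+o⇒m∸n≤o (mid / h) (s / h) (≤-trans blocks (≤-reflexive (+-comm 3 (s / h)))))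

-- Four blocks contribute 4² = 16 to the square, and writing r + 1 as half of 2 + 2r contributes 2;
-- hence 32.
doubled-window-bound : ∀ k h .{{_ : NonZero h}} mid → k ≤ 3 * h → ∀ r s →
  let x = doubled h r (window k mid) s in x * x * (2 + (r + r)) ≤ 32 * 4 ^ r
doubled-window-bound k h mid k≤3h r s = begin
  x * x * (2 + (r + r))      ≤⟨ *-monoˡ-≤ (2 + (r + r)) (*-mono-≤ x≤y x≤y) ⟩
  y * y * (2 + (r + r))      ≡⟨ regroup y r ⟩
  2 * (y * y * suc r)        ≤⟨ *-monoʳ-≤ 2 (sumBelow-square-bound 4 (λ i → doubled 1 r (δ (mid / h)) (s / h + i)) (suc r) λ i →
                                  doubled-δ-bound r (mid / h) (s / h + i)) ⟩
  2 * (16 * 4 ^ r)           ≡⟨ sym (*-assoc 2 16 (4 ^ r)) ⟩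
  32 * 4 ^ r                 ∎
  where
  open ≤-Reasoning
  x = doubled h r (window k mid) s
  y = sumBelow 4 (λ i → doubled 1 r (δ (mid / h)) (s / h + i))
  x≤y : x ≤ y
  x≤y = ≤-trans (doubled-mono h r (window-≤-blocks k h mid k≤3h) s)
    (≤-reflexive (trans (doubled-quotient h r (λ u → sumBelow 4 (λ i → δ (mid / h) (u + i))) s)
                        (doubled-sumBelow r 4 (δ (mid / h)) (s / h))))
  regroup : ∀ y r → y * y * (2 + (r + r)) ≡ 2 * (y * y * suc r)
  regroup = solve-∀

-- Rank sums over the grid

rankSum : ℕ → ℕ → (ℕ → ℕ) → ℕ → ℕ
rankSum k zero    g s = g s
rankSum k (suc m) g s = sumBelow k (λ j → rankSum k m g (s + j))

rankSum-shift : ∀ k m h g s →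
  rankSum k m g s + rankSum k m g (s + h) ≡ rankSum k m (λ s → g s + g (s + h)) s
rankSum-shift k zero    h g s = refl
rankSum-shift k (suc m) h g s = begin
  sumBelow k (λ j → rankSum k m g (s + j)) + sumBelow k (λ j → rankSum k m g (s + h + j))
    ≡⟨ sym (sumBelow-+ k _ _) ⟩
  sumBelow k (λ j → rankSum k m g (s + j) + rankSum k m g (s + h + j))
    ≡⟨ sumBelow-cong k (λ j → trans (cong (λ t → rankSum k m g (s + j) + rankSum k m g t) (swap s h j))
                                    (rankSum-shift k m h g (s + j))) ⟩
  sumBelow k (λ j → rankSum k m (λ s → g s + g (s + h)) (s + j)) ∎
  where
  open ≡-Reasoning
  swap : ∀ s h j → s + h + j ≡ s + j + h
  swap = solve-∀

-- Splits off the coordinate that is not paired: for g = `δ mid` its sum is `window k mid`, the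
-- starting function of the induction below.
rankSum-innermost : ∀ k m g s → rankSum k (suc m) g s ≡ rankSum k m (λ s → sumBelow k (λ j → g (s + j))) s
rankSum-innermost k zero    g s = refl
rankSum-innermost k (suc m) g s = sumBelow-cong k (λ j → rankSum-innermost k m g (s + j))

-- Cauchy–Schwarz in the form 2h (a + b)² ≤ (2h + 1) (a² + 2h b²): a collects the h pairs, b the unpaired value 2h.
odd-step : ∀ h′ Y′ {a b R} → let h = suc h′ ; Y = 2 + Y′ in
  a * a * (2 + Y) ≤ h * h * (4 * R) → b * b * Y ≤ R →
  (b + a) * (b + a) * suc Y ≤ R * (suc (h + h) * suc (h + h))
odd-step h′ Y′ {a} {b} {R} ha hb = *-cancelˡ-≤ ((h + h) * (Y * (2 + Y))) (begin
  (h + h) * (Y * (2 + Y)) * ((b + a) * (b + a) * suc Y)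
    ≡⟨ e₁ h Y a b ⟩
  ((h + h) * (a * a) + 2 * (a * ((h + h) * b)) + (h + h) * (b * b)) * (Y * (2 + Y) * suc Y)
    ≤⟨ *-monoˡ-≤ (Y * (2 + Y) * suc Y) (+-monoˡ-≤ ((h + h) * (b * b)) (+-monoʳ-≤ ((h + h) * (a * a)) (am-gm a ((h + h) * b)))) ⟩
  ((h + h) * (a * a) + (a * a + (h + h) * b * ((h + h) * b)) + (h + h) * (b * b)) * (Y * (2 + Y) * suc Y)
    ≡⟨ e₂ h Y a b ⟩
  suc (h + h) * suc Y * (a * a * (2 + Y) * Y + (h + h) * (b * b * Y * (2 + Y)))
    ≤⟨ *-monoʳ-≤ (suc (h + h) * suc Y) (+-mono-≤ (*-monoˡ-≤ Y ha) (*-monoʳ-≤ (h + h) (*-monoˡ-≤ (2 + Y) hb))) ⟩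
  suc (h + h) * suc Y * (h * h * (4 * R) * Y + (h + h) * (R * (2 + Y)))
    -- The added term is the exact difference of the two sides. Up to a common factor it is 2hY - Y
    -- - 2, nonnegative because h ≥ 1 and Y ≥ 2; this is the reason for h′ and Y′, and for the
    -- summand 2 in the bounds for rank sums.
    ≤⟨ m≤m+n _ ((h + h) * suc (h + h) * R * (h′ * Y + h′ * Y + Y′)) ⟩
  suc (h + h) * suc Y * (h * h * (4 * R) * Y + (h + h) * (R * (2 + Y))) + (h + h) * suc (h + h) * R * (h′ * Y + h′ * Y + Y′)
    ≡⟨ e₃ h′ Y′ R ⟩
  (h + h) * (Y * (2 + Y)) * (R * (suc (h + h) * suc (h + h))) ∎)
  where
  open ≤-Reasoning
  h = suc h′
  Y = 2 + Y′
  e₁ : ∀ h Y a b → (h + h) * (Y * (2 + Y)) * ((b + a) * (b + a) * suc Y) ≡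
       ((h + h) * (a * a) + 2 * (a * ((h + h) * b)) + (h + h) * (b * b)) * (Y * (2 + Y) * suc Y)
  e₁ = solve-∀
  e₂ : ∀ h Y a b → ((h + h) * (a * a) + (a * a + (h + h) * b * ((h + h) * b)) + (h + h) * (b * b)) * (Y * (2 + Y) * suc Y) ≡
       suc (h + h) * suc Y * (a * a * (2 + Y) * Y + (h + h) * (b * b * Y * (2 + Y)))
  e₂ = solve-∀
  e₃ : ∀ h′ Y′ R → let h = suc h′ ; Y = 2 + Y′ in
       suc (h + h) * suc Y * (h * h * (4 * R) * Y + (h + h) * (R * (2 + Y))) + (h + h) * suc (h + h) * R * (h′ * Y + h′ * Y + Y′) ≡
       (h + h) * (Y * (2 + Y)) * (R * (suc (h + h) * suc (h + h)))
  e₃ = solve-∀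

even-step : ∀ h Y {a R} → a * a * (2 + Y) ≤ h * h * (4 * R) → a * a * suc Y ≤ R * ((h + h) * (h + h))
even-step h Y {a} {R} ha = begin
  a * a * suc Y           ≤⟨ *-monoʳ-≤ (a * a) (n≤1+n (suc Y)) ⟩
  a * a * (2 + Y)         ≤⟨ ha ⟩
  h * h * (4 * R)         ≡⟨ regroup h R ⟩
  R * ((h + h) * (h + h)) ∎
  where
  open ≤-Reasoning
  regroup : ∀ h R → h * h * (4 * R) ≡ R * ((h + h) * (h + h))
  regroup = solve-∀

data Halved : ℕ → ℕ → Set where
  even : ∀ {h} → Halved h (h + h)
  odd  : ∀ {h} → Halved h (suc (h + h))

halve : ∀ k → ∃ λ h → Halved h k
halve zero = 0 , even
halve (suc k) with halve k
... | h , even = h , odd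
... | h , odd  = suc h , subst (Halved (suc h)) (cong suc (+-suc h h)) even

-- Induction on the number m of full coordinates, with the number r of two-valued ones free: a full
-- coordinate splits into h pairs j, j + h, each raising r by one, and for odd k a single value that
-- leaves r alone. A full coordinate weighs 1 and a two-valued one 2; for odd k this surplus pays
-- for the unpaired value, since at least two thirds of the values lie in pairs.
rankSum-bound : ∀ {k h′} (g : ℕ → ℕ) → Halved (suc h′) k →
  (∀ r s → let x = doubled (suc h′) r g s in x * x * (2 + (r + r)) ≤ 32 * 4 ^ r) →
  ∀ m r s → let x = rankSum k m (doubled (suc h′) r g) s in
  x * x * (2 + (m + (r + r))) ≤ 32 * 4 ^ r * (k * k) ^ m
rankSum-bound g half base zero r s = ≤-trans (base r s) (≤-reflexive (sym (*-identityʳ _)))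
rankSum-bound {k} {h′} g half base (suc m) r s = conclude half
  where
  h = suc h′
  G = doubled h r g
  Y′ = m + (r + r)
  R = 32 * 4 ^ r * (k * k) ^ m
  a = sumBelow h (λ j → rankSum k m (doubled h (suc r) g) (s + j))
  pairs : sumBelow (h + h) (λ j → rankSum k m G (s + j)) ≡ a
  pairs = trans (sumBelow-double h _) (sumBelow-cong h λ j →
    trans (cong (λ t → rankSum k m G (s + j) + rankSum k m G t) (sym (+-assoc s j h)))
          (rankSum-shift k m h G (s + j)))
  scale : ∀ m r → 2 + (m + (suc r + suc r)) ≡ 4 + (m + (r + r))
  scale = solve-∀
  rescale : ∀ p K → 32 * (4 * p) * K ≡ 4 * (32 * p * K)
  rescale = solve-∀
  a-bound : a * a * (4 + Y′) ≤ h * h * (4 * R)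
  a-bound = sumBelow-square-bound h (λ j → rankSum k m (doubled h (suc r) g) (s + j)) (4 + Y′) λ j →
    subst₂ (λ c A → let x = rankSum k m (doubled h (suc r) g) (s + j) in x * x * c ≤ A)
      (scale m r) (rescale (4 ^ r) ((k * k) ^ m)) (rankSum-bound g half base m (suc r) (s + j))
  regroup : ∀ q P K → q * P * K ≡ q * (P * K)
  regroup = solve-∀
  reassoc : ∀ p q K → p * K * q ≡ p * (q * K)
  reassoc = solve-∀
  conclude : Halved h k → sumBelow k (λ j → rankSum k m G (s + j)) * sumBelow k (λ j → rankSum k m G (s + j)) * (3 + Y′)
             ≤ 32 * 4 ^ r * (k * k * (k * k) ^ m)
  conclude even = subst₂ (λ x A → x * x * (3 + Y′) ≤ A) (sym pairs) (reassoc (32 * 4 ^ r) (k * k) ((k * k) ^ m))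
    (even-step h (2 + Y′) {a} {R} a-bound)
  conclude odd = subst₂ (λ x A → x * x * (3 + Y′) ≤ A) (cong (rankSum k m G (s + (h + h)) +_) (sym pairs))
    (reassoc (32 * 4 ^ r) (k * k) ((k * k) ^ m))
    (odd-step h′ Y′ {a} {rankSum k m G (s + (h + h))} {R} a-bound (rankSum-bound g half base m r (s + (h + h))))

Halved⇒≤3h : ∀ {h k} → Halved (suc h) k → k ≤ 3 * suc h
Halved⇒≤3h {h} even = +-monoʳ-≤ (suc h) (m≤m+n (suc h) _)
Halved⇒≤3h {h} odd  = ≤-trans (m≤m+n _ h) (≤-reflexive (collect h))
  where
  collect : ∀ h → suc (suc h + suc h) + h ≡ 3 * suc h
  collect = solve-∀

layer-bound : ∀ k m mid → 2 ≤ k →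
  let x = rankSum k (suc m) (δ mid) 0 in x * x * (2 + m) ≤ 32 * (k * k) ^ m
layer-bound k m mid 2≤k with halve k
... | zero , even = ⊥-elim (<⇒≱ 2≤k z≤n)
... | zero , odd  = ⊥-elim (<⇒≱ 2≤k ≤-refl)
... | suc h′ , half = subst₂ (λ x c → x * x * c ≤ 32 * (k * k) ^ m)
  (sym (rankSum-innermost k m (δ mid) 0)) (cong (2 +_) (+-identityʳ m))
  (rankSum-bound (window k mid) half (doubled-window-bound k (suc h′) mid (Halved⇒≤3h half)) m 0 0)

-- Chain decomposition of the grid

∑ : {A : Set} → List A → (A → ℕ) → ℕ
∑ []       f = 0
∑ (x ∷ xs) f = f x + ∑ xs f

∑-cong : {A : Set} (xs : List A) {f g : A → ℕ} → (∀ x → f x ≡ g x) → ∑ xs f ≡ ∑ xs g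
∑-cong []       eq = refl
∑-cong (x ∷ xs) eq = cong₂ _+_ (eq x) (∑-cong xs eq)

∑-mono : {A : Set} {xs : List A} {f g : A → ℕ} → All (λ x → f x ≤ g x) xs → ∑ xs f ≤ ∑ xs g
∑-mono []       = z≤n
∑-mono (le ∷ les) = +-mono-≤ le (∑-mono les)

∑-+ : {A : Set} (xs : List A) (f g : A → ℕ) → ∑ xs (λ x → f x + g x) ≡ ∑ xs f + ∑ xs g
∑-+ []       f g = refl
∑-+ (x ∷ xs) f g = trans (cong (f x + g x +_) (∑-+ xs f g)) (+-interchange (f x) (g x) _ _)

∑-* : {A : Set} (xs : List A) (c : ℕ) (f : A → ℕ) → ∑ xs (λ x → c * f x) ≡ c * ∑ xs f
∑-* []       c f = sym (*-zeroʳ c)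
∑-* (x ∷ xs) c f = trans (cong (c * f x +_) (∑-* xs c f)) (sym (*-distribˡ-+ c (f x) _))

∑-const : {A : Set} (xs : List A) (c : ℕ) → ∑ xs (λ _ → c) ≡ length xs * c
∑-const []       c = refl
∑-const (x ∷ xs) c = cong (c +_) (∑-const xs c)

∑-++ : {A : Set} (xs ys : List A) (f : A → ℕ) → ∑ (xs ++ ys) f ≡ ∑ xs f + ∑ ys f
∑-++ []       ys f = refl
∑-++ (x ∷ xs) ys f = trans (cong (f x +_) (∑-++ xs ys f)) (sym (+-assoc (f x) _ _))

∑-map : {A B : Set} (h : A → B) (xs : List A) (f : B → ℕ) → ∑ (map h xs) f ≡ ∑ xs (f ∘ h)
∑-map h []       f = refl
∑-map h (x ∷ xs) f = cong (f (h x) +_) (∑-map h xs f)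

∑-concatMap : {A B : Set} (h : A → List B) (xs : List A) (f : B → ℕ) →
  ∑ (concatMap h xs) f ≡ ∑ xs (λ x → ∑ (h x) f)
∑-concatMap h []       f = refl
∑-concatMap h (x ∷ xs) f = trans (∑-++ (h x) (concatMap h xs) f) (cong (∑ (h x) f +_) (∑-concatMap h xs f))

∑-swap : {A B : Set} (xs : List A) (ys : List B) (f : A → B → ℕ) →
  ∑ xs (λ x → ∑ ys (f x)) ≡ ∑ ys (λ y → ∑ xs (λ x → f x y))
∑-swap []       ys f = sym (trans (∑-const ys 0) (*-zeroʳ (length ys)))
∑-swap (x ∷ xs) ys f = trans (cong (∑ ys (f x) +_) (∑-swap xs ys f)) (sym (∑-+ ys (f x) _))

-- Listed downwards because `hooks` peels off the largest value first.
values : ∀ k → List (Fin k)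
values zero    = []
values (suc k) = Fin.fromℕ k ∷ map Fin.inject₁ (values k)

values-downFrom : ∀ k → map toℕ (values k) ≡ downFrom k
values-downFrom zero    = refl
values-downFrom (suc k) = cong₂ _∷_ (Fin.toℕ-fromℕ k)
  (trans (sym (List.map-∘ (values k))) (trans (List.map-cong Fin.toℕ-inject₁ (values k)) (values-downFrom k)))

∑-downFrom : ∀ k (g : ℕ → ℕ) → ∑ (downFrom k) g ≡ sumBelow k g
∑-downFrom zero    g = refl
∑-downFrom (suc k) g = cong (g k +_) (∑-downFrom k g)

∑-values : ∀ k (g : ℕ → ℕ) → ∑ (values k) (g ∘ toℕ) ≡ sumBelow k g
∑-values k g = trans (sym (∑-map toℕ (values k) g))
  (trans (cong (λ xs → ∑ xs g) (values-downFrom k)) (∑-downFrom k g))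

length-values : ∀ k → length (values k) ≡ k
length-values k = trans (sym (List.length-map toℕ (values k)))
  (trans (cong length (values-downFrom k)) (List.length-downFrom k))

values-descending : ∀ k → AllPairs (λ a b → toℕ b < toℕ a) (values k)
values-descending zero    = []
values-descending (suc k) =
  All.map⁺ (All.universal (λ b → subst₂ _<_ (sym (Fin.toℕ-inject₁ b)) (sym (Fin.toℕ-fromℕ k)) (Fin.toℕ<n b)) (values k))
  ∷ AllPairs.map⁺ (AllPairs.map (λ {a} {b} lt → subst₂ _<_ (sym (Fin.toℕ-inject₁ b)) (sym (Fin.toℕ-inject₁ a)) lt)
                               (values-descending k))

cube : ∀ k m → List (Cube k m)
cube k zero    = [] ∷ []
cube k (suc m) = concatMap (λ b → map (b ∷_) (cube k m)) (values k)

∑-cube-suc : ∀ k m (f : Cube k (suc m) → ℕ) →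
  ∑ (cube k (suc m)) f ≡ ∑ (values k) (λ b → ∑ (cube k m) (λ x → f (b ∷ x)))
∑-cube-suc k m f = trans (∑-concatMap _ (values k) f) (∑-cong (values k) λ b → ∑-map (b ∷_) (cube k m) f)

∑-cube-++ : ∀ k m n (f : Cube k (m + n) → ℕ) →
  ∑ (cube k (m + n)) f ≡ ∑ (cube k m) (λ x → ∑ (cube k n) (λ y → f (x Vec.++ y)))
∑-cube-++ k zero    n f = sym (+-identityʳ _)
∑-cube-++ k (suc m) n f = trans (∑-cube-suc k (m + n) f)
  (trans (∑-cong (values k) λ b → ∑-cube-++ k m n (λ x → f (b ∷ x)))
         (sym (∑-cube-suc k m (λ x → ∑ (cube k n) (λ y → f (x Vec.++ y))))))

length-cube : ∀ k m → length (cube k m) ≡ k ^ m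
length-cube k zero    = refl
length-cube k (suc m) = begin
  length (cube k (suc m))                     ≡⟨ sym (trans (∑-const (cube k (suc m)) 1) (*-identityʳ _)) ⟩
  ∑ (cube k (suc m)) (λ _ → 1)                ≡⟨ ∑-cube-suc k m (λ _ → 1) ⟩
  ∑ (values k) (λ _ → ∑ (cube k m) (λ _ → 1)) ≡⟨ ∑-const (values k) _ ⟩
  length (values k) * ∑ (cube k m) (λ _ → 1)  ≡⟨ cong₂ _*_ (length-values k)
                                                   (trans (trans (∑-const (cube k m) 1) (*-identityʳ _)) (length-cube k m)) ⟩
  k * k ^ m ∎
  where open ≡-Reasoning

rank : ∀ {k m} → Cube k m → ℕ
rank []      = 0
rank (b ∷ x) = toℕ b + rank x

∑-rank : ∀ k m (g : ℕ → ℕ) s → ∑ (cube k m) (λ x → g (s + rank x)) ≡ rankSum k m g s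
∑-rank k zero    g s = trans (+-identityʳ _) (cong g (+-identityʳ s))
∑-rank k (suc m) g s = begin
  ∑ (cube k (suc m)) (λ x → g (s + rank x))
    ≡⟨ ∑-cube-suc k m (λ x → g (s + rank x)) ⟩
  ∑ (values k) (λ b → ∑ (cube k m) (λ x → g (s + (toℕ b + rank x))))
    ≡⟨ ∑-cong (values k) (λ b → trans (∑-cong (cube k m) λ x → cong g (sym (+-assoc s (toℕ b) (rank x))))
                                        (∑-rank k m g (s + toℕ b))) ⟩
  ∑ (values k) (λ b → rankSum k m g (s + toℕ b))
    ≡⟨ ∑-values k (λ j → rankSum k m g (s + j)) ⟩
  rankSum k (suc m) g s ∎
  where open ≡-Reasoning

-- The chains: partition and monotonicity

infix 4 _≺_
_≺_ : ∀ {k m} → Cube k m → Cube k m → Set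
x ≺ y = (∀ i → toℕ (lookup x i) ≤ toℕ (lookup y i)) × ∃ λ i → toℕ (lookup x i) < toℕ (lookup y i)

∷-≺-tail : ∀ {k m} (b : Fin k) {x y : Cube k m} → x ≺ y → (b ∷ x) ≺ (b ∷ y)
∷-≺-tail b (le , i , lt) = (λ { Fin.zero → ≤-refl ; (Fin.suc j) → le j }) , Fin.suc i , lt

∷-≺-head : ∀ {k m} {a b : Fin k} {x y : Cube k m} → toℕ a < toℕ b →
  (∀ i → toℕ (lookup x i) ≤ toℕ (lookup y i)) → (a ∷ x) ≺ (b ∷ y)
∷-≺-head a<b le = (λ { Fin.zero → <⇒≤ a<b ; (Fin.suc j) → le j }) , Fin.zero , a<b

-- Since the values descend, pushing them onto the accumulator leaves the column in ascending order
-- in front of the top row.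
column : ∀ {k m} → List (Fin k) → Cube k m → List (Cube k (suc m)) → List (Cube k (suc m))
column []       x acc = acc
column (b ∷ bs) x acc = column bs x ((b ∷ x) ∷ acc)

-- The de Bruijn–Tengbergen–Kruyswijk decomposition of the product of two chains into hooks:
-- climb the first column, then run along the top row; peel both off and recurse.
hooks : ∀ {k m} → List (Fin k) → List (Cube k m) → List (List (Cube k (suc m)))
hooks (b ∷ bs) (x ∷ xs) = column bs x (map (b ∷_) (x ∷ xs)) ∷ hooks bs xs
hooks []       _        = []
hooks (_ ∷ _)  []       = []

chains : ∀ k m → List (List (Cube k m))
chains k zero    = ([] ∷ []) ∷ []
chains k (suc m) = concatMap (hooks (values k)) (chains k m)

∑-column : ∀ {k m} (bs : List (Fin k)) (x : Cube k m) acc f →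
  ∑ (column bs x acc) f ≡ ∑ bs (λ b → f (b ∷ x)) + ∑ acc f
∑-column []       x acc f = refl
∑-column (b ∷ bs) x acc f = trans (∑-column bs x ((b ∷ x) ∷ acc) f)
  (rotate (∑ bs (λ b → f (b ∷ x))) (f (b ∷ x)) (∑ acc f))
  where
  rotate : ∀ p q r → p + (q + r) ≡ (q + p) + r
  rotate = solve-∀

∑-hooks : ∀ {k m} (bs : List (Fin k)) (c : List (Cube k m)) f →
  ∑ (hooks bs c) (λ c → ∑ c f) ≡ ∑ bs (λ b → ∑ c (λ x → f (b ∷ x)))
∑-hooks []       c        f = refl
∑-hooks (b ∷ bs) []       f = sym (trans (∑-const bs 0) (*-zeroʳ (length bs)))
∑-hooks (b ∷ bs) (x ∷ xs) f = begin
  ∑ (column bs x (map (b ∷_) (x ∷ xs))) f + ∑ (hooks bs xs) (λ c → ∑ c f)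
    ≡⟨ cong₂ _+_ (∑-column bs x _ f) (∑-hooks bs xs f) ⟩
  (P + (f (b ∷ x) + ∑ (map (b ∷_) xs) f)) + Q
    ≡⟨ cong (λ u → (P + (f (b ∷ x) + u)) + Q) (∑-map (b ∷_) xs f) ⟩
  (P + row) + Q
    ≡⟨ rotate P row Q ⟩
  row + (P + Q)
    ≡⟨ cong (row +_) (sym (∑-+ bs _ _)) ⟩
  row + ∑ bs (λ b → f (b ∷ x) + ∑ xs (λ y → f (b ∷ y))) ∎
  where
  open ≡-Reasoning
  P = ∑ bs (λ b → f (b ∷ x))
  Q = ∑ bs (λ b → ∑ xs (λ y → f (b ∷ y)))
  row = f (b ∷ x) + ∑ xs (λ y → f (b ∷ y))
  rotate : ∀ p q r → (p + q) + r ≡ q + (p + r)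
  rotate = solve-∀

-- The partition property, tested against arbitrary weights: each hook step only rearranges the
-- product of a chain with the list of values.
∑-chains : ∀ k m (f : Cube k m → ℕ) → ∑ (chains k m) (λ c → ∑ c f) ≡ ∑ (cube k m) f
∑-chains k zero    f = +-identityʳ _
∑-chains k (suc m) f = begin
  ∑ (chains k (suc m)) (λ c → ∑ c f)
    ≡⟨ ∑-concatMap (hooks (values k)) (chains k m) (λ c → ∑ c f) ⟩
  ∑ (chains k m) (λ c → ∑ (hooks (values k) c) (λ c → ∑ c f))
    ≡⟨ ∑-cong (chains k m) (λ c → ∑-hooks (values k) c f) ⟩
  ∑ (chains k m) (λ c → ∑ (values k) (λ b → ∑ c (λ x → f (b ∷ x))))
    ≡⟨ ∑-swap (chains k m) (values k) _ ⟩
  ∑ (values k) (λ b → ∑ (chains k m) (λ c → ∑ c (λ x → f (b ∷ x))))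
    ≡⟨ ∑-cong (values k) (λ b → ∑-chains k m (λ x → f (b ∷ x))) ⟩
  ∑ (values k) (λ b → ∑ (cube k m) (λ x → f (b ∷ x)))
    ≡⟨ sym (∑-cube-suc k m f) ⟩
  ∑ (cube k (suc m)) f ∎
  where open ≡-Reasoning

column-increasing : ∀ {k m} {bs : List (Fin k)} {x : Cube k m} {acc} →
  AllPairs (λ a b → toℕ b < toℕ a) bs → AllPairs _≺_ acc → All (λ b → All ((b ∷ x) ≺_) acc) bs →
  AllPairs _≺_ (column bs x acc)
column-increasing []          inc below = inc
column-increasing {x = x} (b> ∷ desc) inc (b< ∷ below) = column-increasing desc (b< ∷ inc)
  (All.zipWith (λ {b} (lt , bel) → ∷-≺-head lt (λ _ → ≤-refl) ∷ bel) (b> , below))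

hooks-increasing : ∀ {k m} {bs : List (Fin k)} {c : List (Cube k m)} →
  AllPairs (λ a b → toℕ b < toℕ a) bs → AllPairs _≺_ c → All (AllPairs _≺_) (hooks bs c)
hooks-increasing []          inc = []
hooks-increasing (b> ∷ desc) []  = []
hooks-increasing {bs = b ∷ bs} {x ∷ xs} (b> ∷ desc) (x≺ ∷ inc) =
  column-increasing desc
    (AllPairs.map⁺ {f = b ∷_} (AllPairs.map (∷-≺-tail b) (x≺ ∷ inc)))
    (All.map (λ lt → ∷-≺-head lt (λ _ → ≤-refl) ∷ All.map⁺ (All.map (λ x≺y → ∷-≺-head lt (proj₁ x≺y)) x≺)) b>)
  ∷ hooks-increasing desc inc

chains-increasing : ∀ k m → All (AllPairs _≺_) (chains k m)
chains-increasing k zero    = ([] ∷ []) ∷ []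
chains-increasing k (suc m) = All.concat⁺ (All.map⁺
  (All.map (hooks-increasing (values-descending k)) (chains-increasing k m)))

-- Symmetry and number of the chains

data RanksFrom {k m} : ℕ → List (Cube k m) → Set where
  []  : ∀ {a} → RanksFrom a []
  _∷_ : ∀ {a x c} → rank x ≡ a → RanksFrom (suc a) c → RanksFrom a (x ∷ c)

-- The lowest rank is `start` and the highest `start + height`, so `centred` makes them add up to M.
-- Together with consecutive ranks this forces a point in the middle rank.
record Symmetric {k m} (M : ℕ) (c : List (Cube k m)) : Set where
  constructor symmetric
  field
    {start height} : ℕ
    ranks    : RanksFrom start c
    length≡  : length c ≡ suc height
    centred  : start + start + height ≡ M

column-ranks : ∀ {k m} {x : Cube k m} {acc a} (bs : List (Fin k)) → map toℕ bs ≡ downFrom (length bs) →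
  rank x ≡ a → RanksFrom (length bs + a) acc → RanksFrom a (column bs x acc)
column-ranks []       eq r ranks = ranks
column-ranks (b ∷ bs) eq r ranks = column-ranks bs (List.∷-injectiveʳ eq) r
  (cong₂ _+_ (List.∷-injectiveˡ eq) r ∷ ranks)

length-column : ∀ {k m} (x : Cube k m) {acc} (bs : List (Fin k)) → length (column bs x acc) ≡ length bs + length acc
length-column x []       = refl
length-column x (b ∷ bs) = trans (length-column x bs) (+-suc (length bs) _)

row-ranks : ∀ {k m} (b : Fin k) {c : List (Cube k m)} {a} → RanksFrom a c → RanksFrom (toℕ b + a) (map (b ∷_) c)
row-ranks b []          = []
row-ranks b {x ∷ c} {a} (r ∷ ranks) = cong (toℕ b +_) r ∷
  subst (λ a → RanksFrom a (map (b ∷_) c)) (+-suc (toℕ b) a) (row-ranks b ranks)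

-- Peeling raises a by one and shortens both lists by one, so 2a + |c| + |bs| is invariant; it
-- equals 2 + M because each length exceeds the corresponding height by one. The condition on `bs`
-- keeps the remaining values an initial segment, so that each hook starts at the rank of its x.
hooks-symmetric : ∀ {k m M} (bs : List (Fin k)) {c : List (Cube k m)} {a} → map toℕ bs ≡ downFrom (length bs) →
  RanksFrom a c → a + a + length c + length bs ≡ 2 + M → All (Symmetric M) (hooks bs c)
hooks-symmetric []       eq ranks total = []
hooks-symmetric (b ∷ bs) eq []    total = []
hooks-symmetric {M = M} (b ∷ bs) {x ∷ xs} {a} eq (r ∷ ranks) total =
  symmetric (column-ranks bs (List.∷-injectiveʳ eq) r
              (subst (λ j → RanksFrom (j + a) (map (b ∷_) (x ∷ xs))) (List.∷-injectiveˡ eq) (row-ranks b (r ∷ ranks))))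
            (trans (length-column x bs) (trans (+-suc (length bs) _) (cong (λ l → suc (length bs + l)) (List.length-map (b ∷_) xs))))
            (suc-injective (suc-injective (trans (e₁ a (length xs) (length bs)) total)))
  ∷ hooks-symmetric bs (List.∷-injectiveʳ eq) ranks (trans (e₂ a (length xs) (length bs)) total)
  where
  e₁ : ∀ a l j → 2 + (a + a + (j + l)) ≡ a + a + suc l + suc j
  e₁ = solve-∀
  e₂ : ∀ a l j → suc a + suc a + l + j ≡ a + a + suc l + suc j
  e₂ = solve-∀

chains-symmetric : ∀ k m → All (Symmetric (m * k)) (chains (suc k) m)
chains-symmetric k zero    = symmetric (refl ∷ []) refl refl ∷ []
chains-symmetric k (suc m) = All.concat⁺ (All.map⁺ (All.map extend (chains-symmetric k m)))
  where
  collect : ∀ s h k → s + s + suc h + suc k ≡ 2 + (k + (s + s + h))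
  collect = solve-∀
  extend : ∀ {c} → Symmetric (m * k) c → All (Symmetric (k + m * k)) (hooks (values (suc k)) c)
  extend (symmetric {s} {h} ranks len centred) = hooks-symmetric (values (suc k))
    (trans (values-downFrom (suc k)) (cong downFrom (sym (length-values (suc k))))) ranks
    (trans (cong₂ (λ l j → s + s + l + j) len (length-values (suc k)))
           (trans (collect s h k) (cong (λ M → 2 + (k + M)) centred)))

RanksFrom-hits : ∀ {k m} {c : List (Cube k m)} {a} t → RanksFrom a c → t < length c →
  1 ≤ ∑ c (λ x → δ (a + t) (rank x))
RanksFrom-hits {a = a} zero (refl ∷ ranks) lt rewrite +-identityʳ a | δ-refl a = s≤s z≤n
RanksFrom-hits {c = x ∷ c} {a} (suc t) (r ∷ ranks) (s≤s lt) =
  ≤-trans (subst (λ u → 1 ≤ ∑ c (λ x → δ u (rank x))) (sym (+-suc a t)) (RanksFrom-hits t ranks lt)) (m≤n+m _ (δ (a + suc t) (rank x)))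

⌊a+a+n/2⌋ : ∀ a n → ⌊ a + a + n /2⌋ ≡ a + ⌊ n /2⌋
⌊a+a+n/2⌋ zero    n = refl
⌊a+a+n/2⌋ (suc a) n rewrite +-suc a a = cong suc (⌊a+a+n/2⌋ a n)

Symmetric-hits-middle : ∀ {k m M} {c : List (Cube k m)} → Symmetric M c → 1 ≤ ∑ c (λ x → δ ⌊ M /2⌋ (rank x))
Symmetric-hits-middle {c = c} (symmetric {s} {h} ranks len refl) =
  subst (λ u → 1 ≤ ∑ c (λ x → δ u (rank x))) (sym (⌊a+a+n/2⌋ s h))
    (RanksFrom-hits ⌊ h /2⌋ ranks (subst (⌊ h /2⌋ <_) (sym len) (s≤s (⌊n/2⌋≤n h))))

chains-bound : ∀ k m → 2 ≤ k → let N = length (chains k (suc m)) in N * N * (2 + m) ≤ 32 * (k * k) ^ m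
chains-bound k@(suc k′) m 2≤k = ≤-trans (*-monoˡ-≤ (2 + m) (*-mono-≤ N≤layer N≤layer)) (layer-bound k m mid 2≤k)
  where
  mid = ⌊ suc m * k′ /2⌋
  N = length (chains k (suc m))
  open ≤-Reasoning
  N≤layer : N ≤ rankSum k (suc m) (δ mid) 0
  N≤layer = begin
    N                                                       ≡⟨ sym (trans (∑-const (chains k (suc m)) 1) (*-identityʳ N)) ⟩
    ∑ (chains k (suc m)) (λ _ → 1)                          ≤⟨ ∑-mono (All.map Symmetric-hits-middle (chains-symmetric k′ (suc m))) ⟩
    ∑ (chains k (suc m)) (λ c → ∑ c (λ x → δ mid (rank x))) ≡⟨ ∑-chains k (suc m) (λ x → δ mid (rank x)) ⟩
    ∑ (cube k (suc m)) (λ x → δ mid (rank x))               ≡⟨ ∑-rank k (suc m) (δ mid) 0 ⟩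
    rankSum k (suc m) (δ mid) 0                             ∎

-- Supersaturation along chains

gapPairs : {A : Set} → ℕ → List A → List (A × A)
gapPairs G []       = []
gapPairs G (x ∷ xs) = map (x ,_) (take G xs) ++ gapPairs G xs

length-gapPairs : {A : Set} (G : ℕ) (xs : List A) → length (gapPairs G xs) ≤ length xs * G
length-gapPairs G []       = z≤n
length-gapPairs G (x ∷ xs) = ≤-trans (≤-reflexive (List.length-++ (map (x ,_) (take G xs))))
  (+-mono-≤ (≤-trans (≤-reflexive (trans (List.length-map (x ,_) (take G xs)) (List.length-take G xs))) (m⊓n≤m G (length xs)))
            (length-gapPairs G xs))

gapPairs-All : {A : Set} {R : A → A → Set} (G : ℕ) {xs : List A} → AllPairs R xs →
  All (λ p → R (proj₁ p) (proj₂ p)) (gapPairs G xs)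
gapPairs-All G []         = []
gapPairs-All G (Rx ∷ Rxs) = All.++⁺ (All.map⁺ (All.take⁺ G Rx)) (gapPairs-All G Rxs)

∑-gapPairs-∷ : {A : Set} (G : ℕ) (f : A → ℕ) (x : A) (xs : List A) →
  let h = λ p → f (proj₁ p) * f (proj₂ p) in
  ∑ (gapPairs G (x ∷ xs)) h ≡ f x * ∑ (take G xs) f + ∑ (gapPairs G xs) h
∑-gapPairs-∷ G f x xs = trans (∑-++ (map (x ,_) (take G xs)) (gapPairs G xs) _)
  (cong (_+ ∑ (gapPairs G xs) _) (trans (∑-map (x ,_) (take G xs) _) (∑-* (take G xs) (f x) f)))

-- t counts down the next positions at which a marked element is paired with the previous one.
marked-bound : {A : Set} (G : ℕ) (f : A → ℕ) → (∀ x → f x ≤ 1) → ∀ t g → t + g ≡ G → (xs : List A) →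
  G * ∑ xs f ≤ length xs + g + G * (∑ (take t xs) f + ∑ (gapPairs G xs) (λ p → f (proj₁ p) * f (proj₂ p)))
marked-bound G f f≤1 t g t+g []       rewrite *-zeroʳ G = z≤n
marked-bound G f f≤1 zero g eq (x ∷ xs) rewrite ∑-gapPairs-∷ G f x xs with f x | f≤1 x
... | 0 | _ = ≤-trans (marked-bound G f f≤1 zero g eq xs) (n≤1+n _)
... | suc (suc _) | s≤s ()
-- The countdown has run out, so g = G and this credit pays for x. The countdown restarts at t = G
-- without credit.
... | 1 | _ = ≤-trans
  (≤-trans (≤-reflexive (*-suc G _)) (+-monoʳ-≤ G (marked-bound G f f≤1 G 0 (+-identityʳ G) xs)))
  (≤-trans (n≤1+n _) (≤-reflexive (trans (regroup G (length xs) (∑ (take G xs) f) _)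
    (cong (λ g → suc (length xs) + g + G * (0 + (1 * ∑ (take G xs) f + _))) (sym eq)))))
  where
  regroup : ∀ G l a b → suc (G + (l + 0 + G * (a + b))) ≡ suc l + G + G * (0 + (1 * a + b))
  regroup = solve-∀
marked-bound G f f≤1 (suc t) g eq (x ∷ xs) rewrite ∑-gapPairs-∷ G f x xs with f x | f≤1 x
... | 0 | _ = ≤-trans (marked-bound G f f≤1 t (suc g) (trans (+-suc t g) eq) xs)
  (+-monoˡ-≤ _ (≤-reflexive (+-suc (length xs) g)))
... | suc (suc _) | s≤s ()
-- Here x is within reach of the previous marked element: its own term in the sum over
-- `take (suc t)` stands for that pair and pays for x.
... | 1 | _ = ≤-trans
  (≤-trans (≤-reflexive (*-suc G _)) (+-monoʳ-≤ G (marked-bound G f f≤1 G 0 (+-identityʳ G) xs)))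
  (≤-trans (m≤m+n _ (1 + g + G * ∑ (take t xs) f)) (≤-reflexive (regroup G g (length xs) (∑ (take t xs) f) (∑ (take G xs) f) _)))
  where
  regroup : ∀ G g l c a b → G + (l + 0 + G * (a + b)) + (1 + g + G * c) ≡ suc l + g + G * (1 + c + (1 * a + b))
  regroup = solve-∀

chainPairs : ∀ k m → ℕ → List (Cube k m × Cube k m)
chainPairs k m G = concatMap (gapPairs G) (chains k m)

chainPairs-≺ : ∀ k m G → All (λ p → proj₁ p ≺ proj₂ p) (chainPairs k m G)
chainPairs-≺ k m G = All.concat⁺ (All.map⁺ (All.map (gapPairs-All G) (chains-increasing k m)))

length-as-∑ : {A : Set} (xs : List A) → length xs ≡ ∑ xs (λ _ → 1)
length-as-∑ xs = sym (trans (∑-const xs 1) (*-identityʳ (length xs)))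

∑-length-chains : ∀ k m → ∑ (chains k m) length ≡ k ^ m
∑-length-chains k m = begin
  ∑ (chains k m) length                ≡⟨ ∑-cong (chains k m) length-as-∑ ⟩
  ∑ (chains k m) (λ c → ∑ c (λ _ → 1)) ≡⟨ ∑-chains k m (λ _ → 1) ⟩
  ∑ (cube k m) (λ _ → 1)               ≡⟨ sym (length-as-∑ (cube k m)) ⟩
  length (cube k m)                    ≡⟨ length-cube k m ⟩
  k ^ m                                ∎
  where open ≡-Reasoning

length-chainPairs : ∀ k m G → length (chainPairs k m G) ≤ k ^ m * G
length-chainPairs k m G = begin
  length (chainPairs k m G)                      ≡⟨ length-as-∑ (chainPairs k m G) ⟩
  ∑ (chainPairs k m G) (λ _ → 1)                 ≡⟨ ∑-concatMap (gapPairs G) (chains k m) (λ _ → 1) ⟩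
  ∑ (chains k m) (λ c → ∑ (gapPairs G c) (λ _ → 1)) ≤⟨ ∑-mono (All.universal (λ c → ≤-trans
      (≤-reflexive (sym (length-as-∑ (gapPairs G c)))) (≤-trans (length-gapPairs G c) (≤-reflexive (*-comm (length c) G)))) (chains k m)) ⟩
  ∑ (chains k m) (λ c → G * length c)            ≡⟨ ∑-* (chains k m) G length ⟩
  G * ∑ (chains k m) length                      ≡⟨ cong (G *_) (∑-length-chains k m) ⟩
  G * k ^ m                                      ≡⟨ *-comm G (k ^ m) ⟩
  k ^ m * G                                      ∎
  where open ≤-Reasoning

slice-bound : ∀ k m G (f : Cube k m → ℕ) → (∀ x → f x ≤ 1) →
  G * ∑ (cube k m) f ≤ (k ^ m + length (chains k m) * G) + G * ∑ (chainPairs k m G) (λ p → f (proj₁ p) * f (proj₂ p))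
slice-bound k m G f f≤1 = begin
  G * ∑ (cube k m) f
    ≡⟨ cong (G *_) (sym (∑-chains k m f)) ⟩
  G * ∑ (chains k m) (λ c → ∑ c f)
    ≡⟨ sym (∑-* (chains k m) G (λ c → ∑ c f)) ⟩
  ∑ (chains k m) (λ c → G * ∑ c f)
    -- Every chain starts with t = 0 and hence with full credit g = G; this is the source of the
    -- term `length (chains k m) * G`.
    ≤⟨ ∑-mono (All.universal (marked-bound G f f≤1 0 G refl) (chains k m)) ⟩
  ∑ (chains k m) (λ c → length c + G + G * ∑ (gapPairs G c) h)
    ≡⟨ ∑-+ (chains k m) (λ c → length c + G) (λ c → G * ∑ (gapPairs G c) h) ⟩
  ∑ (chains k m) (λ c → length c + G) + ∑ (chains k m) (λ c → G * ∑ (gapPairs G c) h)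
    ≡⟨ cong₂ _+_ (trans (∑-+ (chains k m) length (λ _ → G)) (cong₂ _+_ (∑-length-chains k m) (∑-const (chains k m) G)))
                 (trans (∑-* (chains k m) G (λ c → ∑ (gapPairs G c) h)) (cong (G *_) (sym (∑-concatMap (gapPairs G) (chains k m) h)))) ⟩
  (k ^ m + length (chains k m) * G) + G * ∑ (chainPairs k m G) h ∎
  where
  open ≤-Reasoning
  h = λ (p : Cube k m × Cube k m) → f (proj₁ p) * f (proj₂ p)

meet : ∀ {k m n} → (Cube k (m + n) → ℕ) → Cube k m → Cube k m → Cube k n → ℕ
meet f x x′ y = f (x Vec.++ y) * f (x′ Vec.++ y)

-- The pairs x, x′ come from chains that do not depend on y, so the slice bounds can be summed over
-- y and the sums interchanged; pair counts in slices become sizes of common sets.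
supersaturation : ∀ k m n G (f : Cube k (m + n) → ℕ) → (∀ x → f x ≤ 1) →
  G * ∑ (cube k (m + n)) f ≤ k ^ n * (k ^ m + length (chains k m) * G)
    + G * ∑ (chainPairs k m G) (λ p → ∑ (cube k n) (meet f (proj₁ p) (proj₂ p)))
supersaturation k m n G f f≤1 = begin
  G * ∑ (cube k (m + n)) f
    ≡⟨ cong (G *_) (trans (∑-cube-++ k m n f) (∑-swap (cube k m) (cube k n) _)) ⟩
  G * ∑ (cube k n) (λ y → ∑ (cube k m) (λ x → f (x Vec.++ y)))
    ≡⟨ sym (∑-* (cube k n) G _) ⟩
  ∑ (cube k n) (λ y → G * ∑ (cube k m) (λ x → f (x Vec.++ y)))
    ≤⟨ ∑-mono (All.universal (λ y → slice-bound k m G (λ x → f (x Vec.++ y)) (λ x → f≤1 _)) (cube k n)) ⟩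
  ∑ (cube k n) (λ y → E + G * ∑ (chainPairs k m G) (λ p → meet f (proj₁ p) (proj₂ p) y))
    ≡⟨ ∑-+ (cube k n) (λ _ → E) _ ⟩
  ∑ (cube k n) (λ _ → E) + ∑ (cube k n) (λ y → G * ∑ (chainPairs k m G) (λ p → meet f (proj₁ p) (proj₂ p) y))
    ≡⟨ cong₂ _+_ (trans (∑-const (cube k n) E) (cong (_* E) (length-cube k n)))
                 (trans (∑-* (cube k n) G _) (cong (G *_) (∑-swap (cube k n) (chainPairs k m G) _))) ⟩
  k ^ n * E + G * ∑ (chainPairs k m G) (λ p → ∑ (cube k n) (meet f (proj₁ p) (proj₂ p))) ∎
  where
  open ≤-Reasoning
  E = k ^ m + length (chains k m) * G

-- With X = G S the counting inequality reads (X − 2T)(X − 6T) ≥ 0, and G is chosen with 2T < X ≤ 3T.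
gap-choice-contradiction : ∀ p M N S → let T = p * M in .{{_ : NonZero S}} → .{{_ : NonZero T}} → S ≤ T → 3 * (M * N) ≤ S →
  (∀ G → ∃ λ D → 12 * (T * T) * D ≤ (p * G) * (S * S * M) × G * S ≤ M * (p + N * G) + G * D) → ⊥
gap-choice-contradiction p M N S {{S≢0}} {{T≢0}} S≤T N-small count =
  <⇒≱ (<-≤-trans (s≤s (≤-trans (m∸n≤m S (2 * T % S)) S≤T)) four) (*-cancelʳ-≤ (4 * T) u u {{u≢0}} square)
  where
  T = p * M
  -- G S is the least multiple of S above 2T, and u is its excess, with 1 ≤ u ≤ S.
  G = suc (2 * T / S)
  u = S ∸ 2 * T % S
  u≢0 : NonZero u
  u≢0 = >-nonZero (m<n⇒0<n∸m (m%n<n (2 * T) S))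
  four : suc T ≤ 4 * T
  four = ≤-trans (+-monoˡ-≤ T (>-nonZero⁻¹ T)) (+-monoʳ-≤ T (m≤m+n T _))
  X≡ : G * S ≡ 2 * T + u
  X≡ = begin
    S + 2 * T / S * S                    ≡⟨ cong (_+ 2 * T / S * S) (sym (m∸n+n≡m (<⇒≤ (m%n<n (2 * T) S)))) ⟩
    u + 2 * T % S + 2 * T / S * S        ≡⟨ +-assoc u _ _ ⟩
    u + (2 * T % S + 2 * T / S * S)      ≡⟨ cong (u +_) (sym (m≡m%n+[m/n]*n (2 * T) S)) ⟩
    u + 2 * T                            ≡⟨ +-comm u _ ⟩
    2 * T + u                            ∎
    where open ≡-Reasoning
  D = proj₁ (count G)
  -- With X = G S, the two bounds turn the count into X ≤ T + X/3 + X²/(12T); this is that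
  -- inequality cleared of denominators.
  quadratic : 8 * T * (G * S) ≤ 12 * (T * T) + (G * S) * (G * S)
  quadratic = *-cancelˡ-≤ T (+-cancelˡ-≤ (4 * (T * T) * (G * S)) _ _ (begin
    4 * (T * T) * (G * S) + T * (8 * T * (G * S))
      ≡⟨ e₁ T (G * S) ⟩
    12 * (T * T) * (G * S)
      ≤⟨ *-monoʳ-≤ (12 * (T * T)) (proj₂ (proj₂ (count G))) ⟩
    12 * (T * T) * (M * (p + N * G) + G * D)
      ≡⟨ e₂ p M N G D ⟩
    12 * (T * T) * T + 4 * (T * T) * (G * (3 * (M * N))) + G * (12 * (T * T) * D)
      ≤⟨ +-mono-≤ (+-monoʳ-≤ (12 * (T * T) * T) (*-monoʳ-≤ (4 * (T * T)) (*-monoʳ-≤ G N-small))) (*-monoʳ-≤ G (proj₁ (proj₂ (count G)))) ⟩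
    12 * (T * T) * T + 4 * (T * T) * (G * S) + G * ((p * G) * (S * S * M))
      ≡⟨ e₃ p M G S ⟩
    4 * (T * T) * (G * S) + T * (12 * (T * T) + (G * S) * (G * S)) ∎))
    where
    open ≤-Reasoning
    e₁ : ∀ T X → 4 * (T * T) * X + T * (8 * T * X) ≡ 12 * (T * T) * X
    e₁ = solve-∀
    e₂ : ∀ p M N G D → let T = p * M in 12 * (T * T) * (M * (p + N * G) + G * D) ≡
         12 * (T * T) * T + 4 * (T * T) * (G * (3 * (M * N))) + G * (12 * (T * T) * D)
    e₂ = solve-∀
    e₃ : ∀ p M G S → let T = p * M in 12 * (T * T) * T + 4 * (T * T) * (G * S) + G * ((p * G) * (S * S * M)) ≡
         4 * (T * T) * (G * S) + T * (12 * (T * T) + (G * S) * (G * S))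
    e₃ = solve-∀
  -- At X = 2T + u the product (X - 2T)(X - 6T) is u (u - 4T).
  square : 4 * T * u ≤ u * u
  square = +-cancelˡ-≤ (16 * (T * T) + 4 * T * u) _ _ (subst₂ _≤_ (e₁ T u) (e₂ T u)
    (subst (λ X → 8 * T * X ≤ 12 * (T * T) + X * X) X≡ quadratic))
    where
    e₁ : ∀ T u → 8 * T * (2 * T + u) ≡ 16 * (T * T) + 4 * T * u + 4 * T * u
    e₁ = solve-∀
    e₂ : ∀ T u → 12 * (T * T) + (2 * T + u) * (2 * T + u) ≡ 16 * (T * T) + 4 * T * u + u * u
    e₂ = solve-∀

-- Induction on the dimension

-- `ContainsBA` with membership replaced by a predicate, because the induction passes to sets of
-- common extensions that are not given as lists. For the predicate `_∈ F` the two agree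
-- definitionally.
BooleanAlgebra : ∀ {k n} → ℕ → (Cube k n → Set) → Set
BooleanAlgebra {k} {n} d P =
  Σ (Cube k n) λ v₀ →
  Σ (Fin d → Fin n → ℕ) λ v →
    (∀ j i → suc (v j i) ≤ k)
  × (∀ j → ∃ λ i → v j i ≢ 0)
  × (∀ j j' → j ≢ j' → ∀ i → v j i ≡ 0 ⊎ v j' i ≡ 0)
  × (∀ (I : Fin d → Bool) → Σ (Cube k n) λ w → P w × (∀ i → val w i ≡ val v₀ i + subsetSum I v i))

point⇒BooleanAlgebra : ∀ {k n} {P : Cube k n → Set} {x} → P x → BooleanAlgebra 0 P
point⇒BooleanAlgebra {x = x} Px =
  x , (λ ()) , (λ ()) , (λ ()) , (λ ()) , λ I → x , Px , λ i → sym (+-identityʳ _)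

↑-elim : ∀ {m n} {P : Fin (m + n) → Set} → (∀ i → P (i ↑ˡ n)) → (∀ i → P (m ↑ʳ i)) → ∀ i → P i
↑-elim {m} {n} {P} l r i = subst P (Fin.join-splitAt m n i) (side (splitAt m i))
  where
  side : ∀ s → P (Fin.join m n s)
  side (inj₁ i) = l i
  side (inj₂ i) = r i

subsetSum-cong : ∀ {d n n′} I {v : Fin d → Fin n → ℕ} {v′ : Fin d → Fin n′ → ℕ} i i′ → (∀ j → v j i ≡ v′ j i′) →
  subsetSum I v i ≡ subsetSum I v′ i′
subsetSum-cong I i i′ eq = cong sum (List.tabulate-cong λ j → cong (λ a → if I j then a else 0) (eq j))

subsetSum-zero : ∀ {n} d I {v : Fin d → Fin n → ℕ} i → (∀ j → v j i ≡ 0) → subsetSum I v i ≡ 0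
subsetSum-zero zero    I i v≡0 = refl
subsetSum-zero (suc d) I {v} i v≡0 rewrite v≡0 Fin.zero with I Fin.zero
... | true  = subsetSum-zero d (I ∘ Fin.suc) {v ∘ Fin.suc} i (v≡0 ∘ Fin.suc)
... | false = subsetSum-zero d (I ∘ Fin.suc) {v ∘ Fin.suc} i (v≡0 ∘ Fin.suc)

-- The new vector lives on the first m coordinates and the old ones on the last n, which makes them
-- disjoint. Including the new vector switches the prefix from x to x′, and the conjunction admits
-- both prefixes. Monotonicity in `x ≺ x′` makes the truncated difference exact, strictness makes it
-- nonzero.
extend-BooleanAlgebra : ∀ {k m n d} {P : Cube k (m + n) → Set} {x x′ : Cube k m} → x ≺ x′ →
  BooleanAlgebra d (λ y → P (x Vec.++ y) × P (x′ Vec.++ y)) → BooleanAlgebra (suc d) P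
extend-BooleanAlgebra {k} {m} {n} {d} {P} {x} {x′} (x≤x′ , i₀ , x<x′) (v₀ , v , v<k , v≢0 , disjoint , sums) =
  x Vec.++ v₀ , v⁺ , bounded , nonzero , disjoint⁺ , sums⁺
  where
  coord : Cube k m → Fin (m + n) → ℕ
  coord z i = toℕ (lookup (z Vec.++ v₀) i)
  v⁺ : Fin (suc d) → Fin (m + n) → ℕ
  v⁺ Fin.zero    i = coord x′ i ∸ coord x i
  v⁺ (Fin.suc j) i = [ (λ _ → 0) , v j ]′ (splitAt m i)
  coordˡ : ∀ z i → coord z (i ↑ˡ n) ≡ toℕ (lookup z i)
  coordˡ z i = cong toℕ (Vec.lookup-++ˡ z v₀ i)
  zeroˡ : ∀ i → v⁺ Fin.zero (i ↑ˡ n) ≡ toℕ (lookup x′ i) ∸ toℕ (lookup x i)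
  zeroˡ i = cong₂ _∸_ (coordˡ x′ i) (coordˡ x i)
  zeroʳ : ∀ i → v⁺ Fin.zero (m ↑ʳ i) ≡ 0
  zeroʳ i = trans (cong₂ _∸_ (cong toℕ (Vec.lookup-++ʳ x′ v₀ i)) (cong toℕ (Vec.lookup-++ʳ x v₀ i))) (n∸n≡0 (toℕ (lookup v₀ i)))
  sucˡ : ∀ j i → v⁺ (Fin.suc j) (i ↑ˡ n) ≡ 0
  sucˡ j i = cong [ (λ _ → 0) , v j ]′ (Fin.splitAt-↑ˡ m i n)
  sucʳ : ∀ j i → v⁺ (Fin.suc j) (m ↑ʳ i) ≡ v j i
  sucʳ j i = cong [ (λ _ → 0) , v j ]′ (Fin.splitAt-↑ʳ m n i)
  bounded : ∀ j i → suc (v⁺ j i) ≤ k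
  bounded Fin.zero    i = ≤-trans (s≤s (m∸n≤m (coord x′ i) (coord x i))) (Fin.toℕ<n (lookup (x′ Vec.++ v₀) i))
  bounded (Fin.suc j) = ↑-elim (λ i → subst (_< k) (sym (sucˡ j i)) (≤-trans (s≤s z≤n) (Fin.toℕ<n (lookup x i))))
                               (λ i → subst (_< k) (sym (sucʳ j i)) (v<k j i))
  nonzero : ∀ j → ∃ λ i → v⁺ j i ≢ 0
  nonzero Fin.zero    = i₀ ↑ˡ n , λ eq → m>n⇒m∸n≢0 x<x′ (trans (sym (zeroˡ i₀)) eq)
  nonzero (Fin.suc j) = m ↑ʳ proj₁ (v≢0 j) , λ eq → proj₂ (v≢0 j) (trans (sym (sucʳ j _)) eq)
  disjoint⁺ : ∀ j j′ → j ≢ j′ → ∀ i → v⁺ j i ≡ 0 ⊎ v⁺ j′ i ≡ 0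
  disjoint⁺ Fin.zero    Fin.zero     j≢j′ i = ⊥-elim (j≢j′ refl)
  disjoint⁺ Fin.zero    (Fin.suc j′) j≢j′ = ↑-elim (λ i → inj₂ (sucˡ j′ i)) (λ i → inj₁ (zeroʳ i))
  disjoint⁺ (Fin.suc j) Fin.zero     j≢j′ = ↑-elim (λ i → inj₁ (sucˡ j i)) (λ i → inj₂ (zeroʳ i))
  disjoint⁺ (Fin.suc j) (Fin.suc j′) j≢j′ = ↑-elim (λ i → inj₁ (sucˡ j i))
    (λ i → subst₂ (λ a b → a ≡ 0 ⊎ b ≡ 0) (sym (sucʳ j i)) (sym (sucʳ j′ i)) (disjoint j j′ (λ eq → j≢j′ (cong Fin.suc eq)) i))
  sums⁺ : ∀ (I : Fin (suc d) → Bool) → Σ (Cube k (m + n)) λ w → P w × (∀ i → val w i ≡ val (x Vec.++ v₀) i + subsetSum I v⁺ i)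
  sums⁺ I with sums (I ∘ Fin.suc)
  ... | w , (Pxw , Px′w) , eq with I Fin.zero
  ... | false = x Vec.++ w , Pxw , ↑-elim
    (λ i → trans (cong suc (trans (cong toℕ (Vec.lookup-++ˡ x w i)) (sym (coordˡ x i))))
      (sym (trans (cong (val (x Vec.++ v₀) (i ↑ˡ n) +_) (subsetSum-zero d _ {v⁺ ∘ Fin.suc} (i ↑ˡ n) (λ j → sucˡ j i))) (+-identityʳ _))))
    (λ i → trans (cong (suc ∘ toℕ) (Vec.lookup-++ʳ x w i)) (trans (eq i)
      (cong₂ _+_ (cong (suc ∘ toℕ) (sym (Vec.lookup-++ʳ x v₀ i)))
                 (sym (subsetSum-cong (I ∘ Fin.suc) {v⁺ ∘ Fin.suc} {v} (m ↑ʳ i) i (λ j → sucʳ j i))))))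
  ... | true  = x′ Vec.++ w , Px′w , ↑-elim
    (λ i → trans (cong (suc ∘ toℕ) (Vec.lookup-++ˡ x′ w i)) (cong suc (sym (trans
      (cong₂ _+_ (coordˡ x i) (cong₂ _+_ (zeroˡ i) (subsetSum-zero d (I ∘ Fin.suc) {v⁺ ∘ Fin.suc} (i ↑ˡ n) (λ j → sucˡ j i))))
      (trans (cong (toℕ (lookup x i) +_) (+-identityʳ _)) (m+[n∸m]≡n (x≤x′ i)))))))
    (λ i → trans (cong (suc ∘ toℕ) (Vec.lookup-++ʳ x′ w i)) (trans (eq i)
      (cong₂ _+_ (cong (suc ∘ toℕ) (sym (Vec.lookup-++ʳ x v₀ i)))
                 (sym (cong₂ _+_ (zeroʳ i) (subsetSum-cong (I ∘ Fin.suc) {v⁺ ∘ Fin.suc} {v} (m ↑ʳ i) i (λ j → sucʳ j i)))))))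

-- This is r + d m, nested so that `size m r (suc d)` reduces to `m + size m r d` and a block is cut
-- off without transport.
size : ℕ → ℕ → ℕ → ℕ
size m r zero    = r
size m r (suc d) = m + size m r d

∑-cube≤ : ∀ k n (f : Cube k n → ℕ) → (∀ x → f x ≤ 1) → ∑ (cube k n) f ≤ k ^ n
∑-cube≤ k n f f≤1 = ≤-trans (∑-mono (All.universal f≤1 (cube k n)))
  (≤-reflexive (trans (sym (length-as-∑ (cube k n))) (length-cube k n)))

^-distrib-* : ∀ x y n → (x * y) ^ n ≡ x ^ n * y ^ n
^-distrib-* x y zero    = refl
^-distrib-* x y (suc n) = trans (cong (x * y *_) (^-distrib-* x y n)) (interchange x y (x ^ n) (y ^ n))
  where
  interchange : ∀ x y a b → x * y * (a * b) ≡ x * a * (y * b)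
  interchange = solve-∀

square-^ : ∀ x n → x ^ (2 * n) ≡ (x * x) ^ n
square-^ x n = trans (sym (^-*-assoc x 2 n)) (cong (λ y → (x * y) ^ n) (*-identityʳ x))

*-mono-≤-square : ∀ {a b} → a ≤ b → a * a ≤ b * b
*-mono-≤-square a≤b = *-mono-≤ a≤b a≤b

-- With α = S / T this is (α/12)^(2e) ≤ (α/12)² ≤ (N / (4p))²: two factors use α ≤ 3N / p, the
-- others α ≤ 1. The 4 is 12 / 3.
sparse-bound : ∀ {p M N S} e .{{_ : NonZero e}} → let T = p * M in S ≤ T → S ≤ 3 * (M * N) →
  16 * (p * p) * S ^ (2 * e) ≤ N * N * (12 * T) ^ (2 * e)
sparse-bound {p} {M} {N} {S} (suc e) S≤T S≤3MN = begin
  16 * (p * p) * S ^ (2 * suc e)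
    ≡⟨ cong (16 * (p * p) *_) (square-^ S (suc e)) ⟩
  16 * (p * p) * (S * S * (S * S) ^ e)
    ≡⟨ e₁ p S ((S * S) ^ e) ⟩
  (4 * p * S) * (4 * p * S) * (S * S) ^ e
    ≤⟨ *-mono-≤ (*-mono-≤-square (*-monoʳ-≤ (4 * p) S≤3MN)) (^-monoˡ-≤ e (*-mono-≤-square (≤-trans S≤T (m≤m+n _ _)))) ⟩
  (4 * p * (3 * (M * N))) * (4 * p * (3 * (M * N))) * (12 * T * (12 * T)) ^ e
    ≡⟨ e₂ p M N ((12 * T * (12 * T)) ^ e) ⟩
  N * N * (12 * T * (12 * T) * (12 * T * (12 * T)) ^ e)
    ≡⟨ cong (N * N *_) (sym (square-^ (12 * T) (suc e))) ⟩
  N * N * (12 * T) ^ (2 * suc e) ∎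
  where
  open ≤-Reasoning
  T = p * M
  e₁ : ∀ p S s → 16 * (p * p) * (S * S * s) ≡ (4 * p * S) * (4 * p * S) * s
  e₁ = solve-∀
  e₂ : ∀ p M N s → let T = p * M in (4 * p * (3 * (M * N))) * (4 * p * (3 * (M * N))) * s ≡ N * N * (12 * T * (12 * T) * s)
  e₂ = solve-∀

-- With α = S / T and β = D / M the hypotheses read (β/12)^e ≤ (N / (4p))² < (α/12)^(2e), whence β ≤
-- α²/12. Instead of extracting e-th roots, the proof raises the opposite inequality to the power e.
dense⇒thin : ∀ {p M N S D} e .{{_ : NonZero p}} .{{_ : NonZero M}} → let T = p * M in
  N * N * (12 * T) ^ (2 * e) < 16 * (p * p) * S ^ (2 * e) →
  16 * (p * p) * D ^ e ≤ N * N * (12 * M) ^ e →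
  12 * (T * T) * D ≤ S * S * M
dense⇒thin {p} {M} {N} {S} {D} e dense thin = ≮⇒≥ λ lt → <⇒≱ (begin-strict
  (N * N * (12 * T) ^ (2 * e)) * M ^ e           <⟨ *-monoˡ-< (M ^ e) {{m^n≢0 M e}} dense ⟩
  (16 * (p * p) * S ^ (2 * e)) * M ^ e           ≡⟨ cong (λ s → 16 * (p * p) * s * M ^ e) (square-^ S e) ⟩
  (16 * (p * p) * (S * S) ^ e) * M ^ e           ≡⟨ trans (*-assoc (16 * (p * p)) _ _)
                                                      (cong (16 * (p * p) *_) (sym (^-distrib-* (S * S) M e))) ⟩
  16 * (p * p) * (S * S * M) ^ e                 ≤⟨ *-monoʳ-≤ (16 * (p * p)) (^-monoˡ-≤ e (<⇒≤ lt)) ⟩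
  16 * (p * p) * (12 * (T * T) * D) ^ e          ≡⟨ cong (16 * (p * p) *_) (^-distrib-* (12 * (T * T)) D e) ⟩
  16 * (p * p) * ((12 * (T * T)) ^ e * D ^ e)    ≡⟨ swap (16 * (p * p)) ((12 * (T * T)) ^ e) (D ^ e) ⟩
  (12 * (T * T)) ^ e * (16 * (p * p) * D ^ e)    ∎)
  (begin
  (12 * (T * T)) ^ e * (16 * (p * p) * D ^ e)    ≤⟨ *-monoʳ-≤ ((12 * (T * T)) ^ e) thin ⟩
  (12 * (T * T)) ^ e * (N * N * (12 * M) ^ e)    ≡⟨ swap ((12 * (T * T)) ^ e) (N * N) ((12 * M) ^ e) ⟩
  N * N * ((12 * (T * T)) ^ e * (12 * M) ^ e)    ≡⟨ cong (N * N *_) (sym (^-distrib-* (12 * (T * T)) (12 * M) e)) ⟩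
  N * N * (12 * (T * T) * (12 * M)) ^ e          ≡⟨ cong (λ x → N * N * x ^ e) (regroup T M) ⟩
  N * N * (12 * T * (12 * T) * M) ^ e            ≡⟨ cong (N * N *_) (^-distrib-* (12 * T * (12 * T)) M e) ⟩
  N * N * ((12 * T * (12 * T)) ^ e * M ^ e)      ≡⟨ sym (*-assoc (N * N) _ _) ⟩
  N * N * (12 * T * (12 * T)) ^ e * M ^ e        ≡⟨ cong (λ x → N * N * x * M ^ e) (sym (square-^ (12 * T) e)) ⟩
  (N * N * (12 * T) ^ (2 * e)) * M ^ e           ∎)
  where
  open ≤-Reasoning
  T = p * M
  swap : ∀ a b c → a * (b * c) ≡ b * (a * c)
  swap = solve-∀
  regroup : ∀ T M → 12 * (T * T) * (12 * M) ≡ 12 * T * (12 * T) * M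
  regroup = solve-∀

-- By contradiction: if the bound failed in dimension d + 1, the induction hypothesis would make
-- every common set thin, against the pair count along the chains. The weight f is what gets summed
-- and P is what carries the Boolean algebra; both pass to products and conjunctions when two
-- prefixes are fixed.
density-bound : ∀ k m r .{{_ : NonZero k}} d (f : Cube k (size m r d) → ℕ) (P : Cube k (size m r d) → Set) →
  (∀ x → f x ≤ 1) → (∀ x → f x ≢ 0 → P x) → ¬ BooleanAlgebra d P →
  let p = k ^ m ; N = length (chains k m) in
  16 * (p * p) * ∑ (cube k (size m r d)) f ^ (2 ^ d) ≤ N * N * (12 * k ^ size m r d) ^ (2 ^ d)
density-bound k m r zero f P f≤1 f⇒P free = ≤-trans (≤-reflexive
  (trans (cong (λ S → 16 * (k ^ m * k ^ m) * S ^ 1) S≡0) (*-zeroʳ (16 * (k ^ m * k ^ m))))) z≤n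
  where
  f≡0 : ∀ x → f x ≡ 0
  f≡0 x with f x ≟ 0
  ... | yes eq = eq
  ... | no  ne = ⊥-elim (free (point⇒BooleanAlgebra (f⇒P x ne)))
  S≡0 : ∑ (cube k r) f ≡ 0
  S≡0 = trans (∑-cong (cube k r) f≡0) (trans (∑-const (cube k r) 0) (*-zeroʳ (length (cube k r))))
density-bound k m r (suc d) f P f≤1 f⇒P free =
  subst (λ T → 16 * (p * p) * S ^ (2 ^ suc d) ≤ N * N * (12 * T) ^ (2 ^ suc d)) (sym (^-distribˡ-+-* k m n)) bound
  where
  n = size m r d
  p = k ^ m
  M = k ^ n
  N = length (chains k m)
  S = ∑ (cube k (m + n)) f
  T = p * M
  e = 2 ^ d
  instance
    p≢0 : NonZero p
    p≢0 = m^n≢0 k m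
    M≢0 : NonZero M
    M≢0 = m^n≢0 k n
    e≢0 : NonZero e
    e≢0 = m^n≢0 2 d
    T≢0 : NonZero T
    T≢0 = m*n≢0 p M
  S≤T : S ≤ T
  S≤T = ≤-trans (∑-cube≤ k (m + n) f f≤1) (≤-reflexive (^-distribˡ-+-* k m n))
  shared : Cube k m × Cube k m → ℕ
  shared q = ∑ (cube k n) (meet f (proj₁ q) (proj₂ q))
  ≢0-factors : ∀ {a b} → a * b ≢ 0 → a ≢ 0 × b ≢ 0
  ≢0-factors {a} ab≢0 = (λ { refl → ab≢0 refl }) , (λ { refl → ab≢0 (*-zeroʳ a) })
  shared-bound : ∀ {q} → proj₁ q ≺ proj₂ q → 16 * (p * p) * shared q ^ e ≤ N * N * (12 * M) ^ e
  shared-bound {x , x′} x≺x′ = density-bound k m r d (meet f x x′) (λ y → P (x Vec.++ y) × P (x′ Vec.++ y))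
    (λ y → *-mono-≤ (f≤1 (x Vec.++ y)) (f≤1 (x′ Vec.++ y)))
    (λ y ne → let l , r = ≢0-factors ne in f⇒P _ l , f⇒P _ r)
    (λ ba → free (extend-BooleanAlgebra x≺x′ ba))
  bound : 16 * (p * p) * S ^ (2 * e) ≤ N * N * (12 * T) ^ (2 * e)
  bound with S ≤? 3 * (M * N)
  ... | yes S≤ = sparse-bound {p} {M} {N} {S} e S≤T S≤
  ... | no  S≰ = ≮⇒≥ λ dense → gap-choice-contradiction p M N S {{>-nonZero (≤-<-trans z≤n (≰⇒> S≰))}} S≤T (<⇒≤ (≰⇒> S≰))
    λ G → ∑ (chainPairs k m G) shared , pairs dense G ,
      supersaturation k m n G f f≤1
    where
    pairs : N * N * (12 * T) ^ (2 * e) < 16 * (p * p) * S ^ (2 * e) → ∀ G →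
      12 * (T * T) * ∑ (chainPairs k m G) shared ≤ p * G * (S * S * M)
    pairs dense G = begin
      12 * (T * T) * ∑ (chainPairs k m G) shared
        ≡⟨ sym (∑-* (chainPairs k m G) (12 * (T * T)) shared) ⟩
      ∑ (chainPairs k m G) (λ q → 12 * (T * T) * shared q)
        ≤⟨ ∑-mono (All.map (λ x≺x′ → dense⇒thin {p} {M} {N} {S} e dense (shared-bound x≺x′)) (chainPairs-≺ k m G)) ⟩
      ∑ (chainPairs k m G) (λ _ → S * S * M)
        ≡⟨ ∑-const (chainPairs k m G) (S * S * M) ⟩
      length (chainPairs k m G) * (S * S * M)
        ≤⟨ *-monoˡ-≤ (S * S * M) (length-chainPairs k m G) ⟩
      p * G * (S * S * M) ∎
      where open ≤-Reasoning

-- Families given by lists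

indicator : ∀ {k n} → Cube k n → Cube k n → ℕ
indicator []      []      = 1
indicator (a ∷ x) (b ∷ y) = δ (toℕ a) (toℕ b) * indicator x y

indicator-refl : ∀ {k n} (x : Cube k n) → indicator x x ≡ 1
indicator-refl []      = refl
indicator-refl (a ∷ x) = cong₂ _*_ (δ-refl (toℕ a)) (indicator-refl x)

indicator-≢ : ∀ {k n} {x y : Cube k n} → x ≢ y → indicator x y ≡ 0
indicator-≢ {x = []}    {[]}    x≢y = ⊥-elim (x≢y refl)
indicator-≢ {x = a ∷ x} {b ∷ y} x≢y with toℕ a ≟ toℕ b
... | no  a≢b = cong (_* indicator x y) (δ-≢ a≢b)
... | yes a≡b = trans (cong (δ (toℕ a) (toℕ b) *_) (indicator-≢ λ x≡y → x≢y (cong₂ _∷_ (Fin.toℕ-injective a≡b) x≡y)))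
                      (*-zeroʳ (δ (toℕ a) (toℕ b)))

sumBelow-δ : ∀ n {j} → j < n → sumBelow n (λ i → δ i j) ≡ 1
sumBelow-δ n {j} j<n = ≤-antisym
  (≤-trans (≤-reflexive (sumBelow-cong n λ i → δ-comm i j)) (sumBelow-δ-≤1 n j 0))
  (≤-trans (≤-reflexive (sym (δ-refl j))) (sumBelow-lower n (λ i → δ i j) j<n))
  where
  δ-comm : ∀ i j → δ i j ≡ δ j i
  δ-comm zero    zero    = refl
  δ-comm zero    (suc j) = refl
  δ-comm (suc i) zero    = refl
  δ-comm (suc i) (suc j) = δ-comm i j

∑-indicator : ∀ k n (y : Cube k n) → ∑ (cube k n) (λ x → indicator x y) ≡ 1
∑-indicator k zero    []      = refl
∑-indicator k (suc n) (b ∷ y) = begin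
  ∑ (cube k (suc n)) (λ x → indicator x (b ∷ y))
    ≡⟨ ∑-cube-suc k n (λ x → indicator x (b ∷ y)) ⟩
  ∑ (values k) (λ a → ∑ (cube k n) (λ x → δ (toℕ a) (toℕ b) * indicator x y))
    ≡⟨ ∑-cong (values k) (λ a → trans (∑-* (cube k n) (δ (toℕ a) (toℕ b)) (λ x → indicator x y))
         (trans (cong (δ (toℕ a) (toℕ b) *_) (∑-indicator k n y)) (*-identityʳ _))) ⟩
  ∑ (values k) (λ a → δ (toℕ a) (toℕ b))
    ≡⟨ ∑-values k (λ i → δ i (toℕ b)) ⟩
  sumBelow k (λ i → δ i (toℕ b))
    ≡⟨ sumBelow-δ k (Fin.toℕ<n b) ⟩
  1 ∎
  where open ≡-Reasoning

multiplicity : ∀ {k n} → List (Cube k n) → Cube k n → ℕ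
multiplicity F x = ∑ F (indicator x)

∑-multiplicity : ∀ {k n} (F : List (Cube k n)) → ∑ (cube k n) (multiplicity F) ≡ length F
∑-multiplicity {k} {n} F = trans (∑-swap (cube k n) F indicator)
  (trans (∑-cong F (∑-indicator k n)) (sym (length-as-∑ F)))

multiplicity-∉ : ∀ {k n} {F : List (Cube k n)} {x} → All (x ≢_) F → multiplicity F x ≡ 0
multiplicity-∉ []           = refl
multiplicity-∉ (x≢y ∷ x∉F) = cong₂ _+_ (indicator-≢ x≢y) (multiplicity-∉ x∉F)

_≟ᶜ_ : ∀ {k n} (x y : Cube k n) → Dec (x ≡ y)
_≟ᶜ_ = Vec.≡-dec Fin._≟_

multiplicity-≤1 : ∀ {k n} {F : List (Cube k n)} → Unique F → ∀ x → multiplicity F x ≤ 1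
multiplicity-≤1 []                     x = z≤n
multiplicity-≤1 {F = y ∷ F} (y∉F ∷ uniq) x with x ≟ᶜ y
... | no  x≢y  rewrite indicator-≢ x≢y = multiplicity-≤1 uniq x
... | yes refl rewrite indicator-refl x | multiplicity-∉ y∉F = ≤-refl

multiplicity⇒∈ : ∀ {k n} {F : List (Cube k n)} {x} → multiplicity F x ≢ 0 → x ∈ F
multiplicity⇒∈ {F = []}        ne = ⊥-elim (ne refl)
multiplicity⇒∈ {F = y ∷ F} {x} ne with x ≟ᶜ y
... | yes refl = here refl
... | no  x≢y  = there (multiplicity⇒∈ λ eq → ne (cong₂ _+_ (indicator-≢ x≢y) eq))

-- Assembling the constants

size≡ : ∀ m r d → size m r d ≡ r + d * m
size≡ m r zero    = sym (+-identityʳ r)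
size≡ m r (suc d) = trans (cong (m +_) (size≡ m r d)) (swap m r (d * m))
  where
  swap : ∀ a b c → a + (b + c) ≡ b + (a + c)
  swap = solve-∀

n<b^n : ∀ b n → 2 ≤ b → n < b ^ n
n<b^n b zero    2≤b = s≤s z≤n
n<b^n b (suc n) 2≤b = ≤-trans (s≤s (≤-trans (m≤n+m (suc n) n) (≤-reflexive (collect n)))) (*-mono-≤ 2≤b (n<b^n b n 2≤b))
  where
  collect : ∀ n → n + suc n ≡ n + suc (n + 0)
  collect = solve-∀

4*d≤4^2^d : ∀ d → 4 * d ≤ 4 ^ (2 ^ d)
4*d≤4^2^d d = ≤-trans (*-monoʳ-≤ 4 (<⇒≤ (n<b^n 2 d ≤-refl))) (4*x≤4^x (2 ^ d))
  where
  4*x≤4^x : ∀ x → 4 * x ≤ 4 ^ x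
  4*x≤4^x zero    = z≤n
  4*x≤4^x (suc x) = *-monoʳ-≤ 4 (n<b^n 4 x (s≤s (s≤s z≤n)))

-- The bound on n trades 2 + m for n at the cost of 2d, and 32 · 2d / 16 = 4d. Since N is bounded by
-- k^m while p = k^(m+1), a factor k² is gained; it is the `k * k` of the conclusion.
combine-bounds : ∀ k m d n T S .{{_ : NonZero k}} N → let p = k ^ suc m ; e = 2 ^ d in
  n ≤ 2 * d * (2 + m) → N * N * (2 + m) ≤ 32 * (k * k) ^ m →
  16 * (p * p) * S ^ e ≤ N * N * (12 * T) ^ e →
  S ^ e * (k * k) * n ≤ 48 ^ e * T ^ e
combine-bounds k m d n T S N n≤ N-bound dense = ≤-trans
  (*-cancelˡ-≤ (16 * (p * p)) {{m*n≢0 16 (p * p) {{_}} {{m*n≢0 p p {{m^n≢0 k (suc m)}} {{m^n≢0 k (suc m)}}}}}} (begin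
    16 * (p * p) * (S ^ e * (k * k) * n)                   ≡⟨ e₁ (16 * (p * p)) (S ^ e) (k * k) n ⟩
    16 * (p * p) * S ^ e * ((k * k) * n)                   ≤⟨ *-mono-≤ dense (*-monoʳ-≤ (k * k) n≤) ⟩
    N * N * (12 * T) ^ e * ((k * k) * (2 * d * (2 + m)))   ≡⟨ e₂ (N * N) ((12 * T) ^ e) (k * k) d m ⟩
    N * N * (2 + m) * ((k * k) * (2 * d) * (12 * T) ^ e)   ≤⟨ *-monoˡ-≤ ((k * k) * (2 * d) * (12 * T) ^ e) N-bound ⟩
    32 * (k * k) ^ m * ((k * k) * (2 * d) * (12 * T) ^ e)  ≡⟨ e₃ ((k * k) ^ m) (k * k) d ((12 * T) ^ e) ⟩
    16 * ((k * k) * (k * k) ^ m) * (4 * d * (12 * T) ^ e)  ≡⟨ cong (λ q → 16 * q * (4 * d * (12 * T) ^ e)) (^-distrib-* k k (suc m)) ⟩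
    16 * (p * p) * (4 * d * (12 * T) ^ e)                  ∎))
  (begin
    4 * d * (12 * T) ^ e       ≤⟨ *-monoˡ-≤ ((12 * T) ^ e) (4*d≤4^2^d d) ⟩
    4 ^ e * (12 * T) ^ e       ≡⟨ sym (^-distrib-* 4 (12 * T) e) ⟩
    (4 * (12 * T)) ^ e         ≡⟨ cong (_^ e) (sym (*-assoc 4 12 T)) ⟩
    (48 * T) ^ e               ≡⟨ ^-distrib-* 48 T e ⟩
    48 ^ e * T ^ e             ∎)
  where
  open ≤-Reasoning
  p = k ^ suc m
  e = 2 ^ d
  e₁ : ∀ a s q n → a * (s * q * n) ≡ a * s * (q * n)
  e₁ = solve-∀
  e₂ : ∀ a t q d m → a * t * (q * (2 * d * (2 + m))) ≡ a * (2 + m) * (q * (2 * d) * t)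
  e₂ = solve-∀
  e₃ : ∀ s q d t → 32 * s * (q * (2 * d) * t) ≡ 16 * (q * s) * (4 * d * t)
  e₃ = solve-∀

-- The inequality of the theorem raised to the power 2^d: the factors k^(-1/2^(d-1)) and n^(-1/2^d)
-- become k^(-2) and n^(-1), which are moved to the left.
grid-bound : ∀ k n d → 2 ≤ k → 1 ≤ d → d ≤ n → (F : List (Cube k n)) → Unique F → ¬ ContainsBA d F →
  length F ^ (2 ^ d) * (k * k) * n ≤ 48 ^ (2 ^ d) * k ^ (n * 2 ^ d)
grid-bound k@(suc _) n d@(suc _) 2≤k 1≤d d≤n = split (n / d) (n % d) (m≥n⇒m/n>0 d≤n) (<⇒≤ (m%n<n n d))
  (trans (size≡ (n / d) (n % d) d) (trans (cong (n % d +_) (*-comm d (n / d))) (sym (m≡m%n+[m/n]*n n d))))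
  where
  -- Quotient and remainder are generalised so that the equation for n can be matched by `refl`; 1 ≤
  -- m reflects d ≤ n.
  split : ∀ {n} m r → 1 ≤ m → r ≤ d → size m r d ≡ n → (F : List (Cube k n)) → Unique F → ¬ ContainsBA d F →
    length F ^ (2 ^ d) * (k * k) * n ≤ 48 ^ (2 ^ d) * k ^ (n * 2 ^ d)
  split (suc m) r _ r≤d refl F uniq free = subst (λ K → length F ^ (2 ^ d) * (k * k) * n′ ≤ 48 ^ (2 ^ d) * K)
    (^-*-assoc k n′ (2 ^ d))
    (combine-bounds k m d n′ (k ^ n′) (length F) (length (chains k (suc m))) n′≤ (chains-bound k m 2≤k)
      (subst (λ S → 16 * (p * p) * S ^ (2 ^ d) ≤ N * N * (12 * k ^ n′) ^ (2 ^ d)) (∑-multiplicity F)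
        (density-bound k (suc m) r d (multiplicity F) (_∈ F) (multiplicity-≤1 uniq) (λ x → multiplicity⇒∈) free)))
    where
    n′ = size (suc m) r d
    p = k ^ suc m
    N = length (chains k (suc m))
    open ≤-Reasoning
    collect : ∀ d m → d + d * suc m + d * suc m + d * 1 ≡ 2 * d * (2 + m)
    collect = solve-∀
    n′≤ : n′ ≤ 2 * d * (2 + m)
    n′≤ = begin
      n′                                      ≡⟨ size≡ (suc m) r d ⟩
      r + d * suc m                           ≤⟨ +-monoˡ-≤ (d * suc m) r≤d ⟩
      d + d * suc m                           ≤⟨ ≤-trans (m≤m+n _ (d * suc m)) (m≤m+n _ (d * 1)) ⟩
      d + d * suc m + d * suc m + d * 1       ≡⟨ collect d m ⟩
      2 * d * (2 + m)                         ∎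

-- Set families inside [2]^n

positive : ℕ → Bool
positive zero    = false
positive (suc _) = true

positive-+ : ∀ a b → positive (a + b) ≡ positive a ∨ positive b
positive-+ zero    b = refl
positive-+ (suc a) b = refl

bit : Bool → Fin 2
bit false = Fin.zero
bit true  = Fin.suc Fin.zero

positive-bit : ∀ b → positive (toℕ (bit b)) ≡ b
positive-bit false = refl
positive-bit true  = refl

anyIn-positive : ∀ {n} d (I : Fin d → Bool) (v : Fin d → Fin n → ℕ) i →
  anyIn I (λ j i → positive (v j i)) i ≡ positive (subsetSum I v i)
anyIn-positive zero    I v i = refl
anyIn-positive (suc d) I v i = trans
  (cong₂ _∨_ (head (I Fin.zero)) (anyIn-positive d (I ∘ Fin.suc) (v ∘ Fin.suc) i))
  (sym (positive-+ (if I Fin.zero then v Fin.zero i else 0) _))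
  where
  head : ∀ b → b ∧ positive (v Fin.zero i) ≡ positive (if b then v Fin.zero i else 0)
  head true  = refl
  head false = refl

summand≤subsetSum : ∀ {n} d (v : Fin d → Fin n → ℕ) j i → v j i ≤ subsetSum (λ _ → true) v i
summand≤subsetSum (suc d) v Fin.zero    i = m≤m+n _ _
summand≤subsetSum (suc d) v (Fin.suc j) i = ≤-trans (summand≤subsetSum d (v ∘ Fin.suc) j i) (m≤n+m _ (v Fin.zero i))

-- The map `positive` takes + to ∨, so it carries the sums over I to unions, and disjointness of
-- supports to disjointness of sets.
ContainsBA⇒ContainsBAset : ∀ {n d} {F : List (PSet n)} → ContainsBA d (map (Vec.map bit) F) → ContainsBAset d F
ContainsBA⇒ContainsBAset {n} {d} {F} (v₀ , v , v<2 , v≢0 , disjoint , sums) =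
  X₀ , X , nonempty , avoids , disjoint′ , unions
  where
  X₀ : PSet n
  X₀ = Vec.map (positive ∘ toℕ) v₀
  X : Fin d → Fin n → Bool
  X j i = positive (v j i)
  positive-true : ∀ {a} → positive a ≡ true → 1 ≤ a
  positive-true {suc a} _ = s≤s z≤n
  nonempty : ∀ j → ∃ λ i → X j i ≡ true
  nonempty j with v≢0 j
  ... | i , ne with v j i in eq
  ... | zero  = ⊥-elim (ne refl)
  ... | suc _ = i , cong positive eq
  -- The sum of all d vectors with v₀ still has entries at most 2, so a coordinate that v j raises
  -- has value 1 in v₀.
  avoids : ∀ j i → X j i ≡ true → lookup X₀ i ≡ false
  avoids j i Xji = trans (Vec.lookup-map i (positive ∘ toℕ) v₀) (cong positive (n≤0⇒n≡0 (s≤s⁻¹ (s≤s⁻¹ (begin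
    2 + toℕ (lookup v₀ i)                 ≡⟨ +-comm 1 (val v₀ i) ⟩
    val v₀ i + 1                          ≤⟨ +-monoʳ-≤ (val v₀ i) (≤-trans (positive-true Xji) (summand≤subsetSum d v j i)) ⟩
    val v₀ i + subsetSum (λ _ → true) v i ≡⟨ sym (proj₂ (proj₂ (sums (λ _ → true))) i) ⟩
    val w i                               ≤⟨ Fin.toℕ<n (lookup w i) ⟩
    2                                     ∎)))))
    where
    open ≤-Reasoning
    w = proj₁ (sums (λ _ → true))
  disjoint′ : ∀ j j′ → j ≢ j′ → ∀ i → X j i ≡ false ⊎ X j′ i ≡ false
  disjoint′ j j′ j≢j′ i = [ (λ eq → inj₁ (cong positive eq)) , (λ eq → inj₂ (cong positive eq)) ]′ (disjoint j j′ j≢j′ i)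
  unions : ∀ I → Vec.tabulate (λ i → lookup X₀ i ∨ anyIn I X i) ∈ F
  unions I with sums I
  ... | w , w∈ , eq with ∈-map⁻ (Vec.map bit) w∈
  ... | u , u∈F , refl = subst (_∈ F) (trans (sym (Vec.tabulate∘lookup u)) (Vec.tabulate-cong λ i → begin
    lookup u i                                                   ≡⟨ sym (positive-bit (lookup u i)) ⟩
    positive (toℕ (bit (lookup u i)))                            ≡⟨ cong (positive ∘ toℕ) (sym (Vec.lookup-map i bit u)) ⟩
    positive (toℕ (lookup (Vec.map bit u) i))                    ≡⟨ cong positive (suc-injective (eq i)) ⟩
    positive (toℕ (lookup v₀ i) + subsetSum I v i)               ≡⟨ positive-+ (toℕ (lookup v₀ i)) (subsetSum I v i) ⟩
    positive (toℕ (lookup v₀ i)) ∨ positive (subsetSum I v i)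
      ≡⟨ cong₂ _∨_ (sym (Vec.lookup-map i (positive ∘ toℕ) v₀)) (sym (anyIn-positive d I v i)) ⟩
    lookup X₀ i ∨ anyIn I X i                                    ∎)) u∈F
    where open ≡-Reasoning

map-bit-injective : ∀ {n} {x y : PSet n} → Vec.map bit x ≡ Vec.map bit y → x ≡ y
map-bit-injective {x = x} {y} eq = trans (sym (decode x)) (trans (cong (Vec.map (positive ∘ toℕ)) eq) (decode y))
  where
  decode : ∀ {n} (x : PSet n) → Vec.map (positive ∘ toℕ) (Vec.map bit x) ≡ x
  decode x = trans (sym (Vec.map-∘ (positive ∘ toℕ) bit x)) (trans (Vec.map-cong positive-bit x) (Vec.map-id x))

powerset-bound : ∀ n d → 1 ≤ d → d ≤ n → (F : List (PSet n)) → Unique F → ¬ ContainsBAset d F →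
  length F ^ (2 ^ d) * n ≤ 48 ^ (2 ^ d) * 2 ^ (n * 2 ^ d)
powerset-bound n d 1≤d d≤n F uniq free = ≤-trans
  (*-monoˡ-≤ n (m≤m*n (length F ^ (2 ^ d)) 4))
  (subst (λ l → l ^ (2 ^ d) * 4 * n ≤ 48 ^ (2 ^ d) * 2 ^ (n * 2 ^ d)) (List.length-map (Vec.map bit) F)
    (grid-bound 2 n d ≤-refl 1≤d d≤n (map (Vec.map bit) F) (map⁺ map-bit-injective uniq)
      (free ∘ ContainsBA⇒ContainsBAset)))

theorem7 : Σ ℕ λ C → 1 ≤ C
    × (∀ (k n d : ℕ) → 2 ≤ k → 1 ≤ d → d ≤ n → (F : List (Cube k n)) → Unique F
    → ¬ ContainsBA d F
    → length F ^ (2 ^ d) * (k * k) * n ≤ C ^ (2 ^ d) * k ^ (n * 2 ^ d))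
    × (∀ (n d : ℕ) → 1 ≤ d → d ≤ n → (F : List (PSet n)) → Unique F
    → ¬ ContainsBAset d F
    → length F ^ (2 ^ d) * n ≤ C ^ (2 ^ d) * 2 ^ (n * 2 ^ d))
theorem7 = 48 , s≤s z≤n , grid-bound , powerset-bound
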